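{- Let $T_0$ be any initial BST. For every $\epsilon>0$ there exists a query sequence $X$ such that $$\mathrm{cost}(GF,\mathrm{rev}(X),T_0)\ge(2-\epsilon)\cdot\mathrm{cost}(GF,X,T_0),$$ where $\mathrm{rev}(X)$ denotes the sequence $X$ in reverse order.
   Context: Binary search tree model. Keys are $\{1,\dots,n\}$. A query sequence is $X=[x_1,\dots,x_m]\in[n]^m$ and $T_0$ is an initial binary search tree (BST) on the keys. An algorithm $A$ serves $x_1,\dots,x_m$ in order. Before serving $x_t$ it holds a BST $T_{t-1}$; it searches $x_t$ from the root and may then restructure the tree by rotations into $T_t$. Let $P_t$ be the set of nodes on the root-to-$x_t$ path of $T_{t-1}$, and let $U_t$ be the node set of the minimal subtree containing all edges rotated in transforming $T_{t-1}$ into $T_t$. The cost at time $t$ is $|P_t\cup U_t|$, and $\mathrm{cost}(A,X,T_0)$ is the sum of these costs over $t=1,\dots,m$. Greedy Future ($GF$). After finding $x_t$ in $T_{t-1}$, let $v_1<\dots<v_k$ be the keys on the root-to-$x_t$ path, set $v_0=-\infty$ and $v_{k+1}=+\infty$, and let $R_0,\dots,R_k$ be the subtrees hanging off this path. For each $i$, $\tau(v_i)$ is the smallest $s>t$ with $x_s\in(v_{i-1},v_{i+1})$, or $+\infty$ if there is none. $GF$ rearranges $v_1,\dots,v_k$ as a treap: a BST in key order and a heap in $\tau$, with the smallest $\tau$ at the top. Ties in $\tau$ are broken in favor of the node of smaller depth in $T_{t-1}$. It then reattaches $R_0,\dots,R_k$ unchanged at their unique positions, giving $T_t$.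
   Formalization: The query sequence X is required to be nonempty, and the number n of keys of the initial BST T_0 must be at least some N depending on ε only (for n = 1 the claim fails for every nonempty X when ε < 1, since every query costs 1). -}

module Defs where

open import Data.Bool.Base using (if_then_else_)
open import Data.Fin.Base using (Fin; _<_)
open import Data.Fin.Properties using (_<?_; <-cmp; all?)
open import Data.Fin.Subset using (Subset; _∈_; ⊥; ⁅_⁆; _∪_; _∩_; ∣_∣)
open import Data.Fin.Subset.Properties using (_∈?_; _⊆?_; nonempty?)
open import Data.List.Base using (List; []; _∷_; _++_; allFin)
open import Data.Nat.Base as ℕ using (ℕ; zero; suc)
open import Data.Nat.Properties as ℕ using ()
open import Data.Product.Base using (∃; _×_; _,_)
open import Relation.Binary.Construct.Closure.ReflexiveTransitive
  using (Star; ε; _◅_; _◅◅_; gmap)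
open import Relation.Binary.Definitions using (tri<; tri≈; tri>)
open import Relation.Binary.PropositionalEquality.Core using (_≡_)
open import Relation.Nullary.Decidable.Core
  using (Dec; yes; no; does; _×-dec_; _→-dec_)

private
  variable
    n : ℕ

-- The n keys are the elements of Fin n, which is order-isomorphic to {1,…,n}.

data Tree (n : ℕ) : Set where
  leaf : Tree n
  node : (l : Tree n) (v : Fin n) (r : Tree n) → Tree n

inorder : Tree n → List (Fin n)
inorder leaf         = []
inorder (node l v r) = inorder l ++ v ∷ inorder r

record BST (n : ℕ) : Set where
  field
    tree    : Tree n
    ordered : inorder tree ≡ allFin n

open BST public

keys : Tree n → Subset n
keys leaf         = ⊥
keys (node l v r) = keys l ∪ (⁅ v ⁆ ∪ keys r)

path : Fin n → Tree n → Subset n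
path x leaf = ⊥
path x (node l v r) with <-cmp x v
... | tri< _ _ _ = ⁅ v ⁆ ∪ path x l
... | tri≈ _ _ _ = ⁅ v ⁆
... | tri> _ _ _ = ⁅ v ⁆ ∪ path x r

infix 4 _⟶_ _⟶*_

data _⟶_ {n : ℕ} : Tree n → Tree n → Set where
  right : ∀ {a u b v c} → node (node a u b) v c ⟶ node a u (node b v c)
  left  : ∀ {a u b v c} → node a u (node b v c) ⟶ node (node a u b) v c
  inˡ   : ∀ {l l′ v r} → l ⟶ l′ → node l v r ⟶ node l′ v r
  inʳ   : ∀ {l v r r′} → r ⟶ r′ → node l v r ⟶ node l v r′

_⟶*_ : Tree n → Tree n → Set
_⟶*_ = Star _⟶_

-- The two endpoints of the edge that is rotated.

edge : {T T′ : Tree n} → T ⟶ T′ → Subset n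
edge (right {u = u} {v = v}) = ⁅ u ⁆ ∪ ⁅ v ⁆
edge (left  {u = u} {v = v}) = ⁅ u ⁆ ∪ ⁅ v ⁆
edge (inˡ ρ)                 = edge ρ
edge (inʳ ρ)                 = edge ρ

rotated : {T T′ : Tree n} → T ⟶* T′ → Subset n
rotated ε        = ⊥
rotated (ρ ◅ ρs) = edge ρ ∪ rotated ρs

-- All nodes of T having a node of S in the subtree below (and including) them.

ancestors : Tree n → Subset n → Subset n
ancestors leaf           S = ⊥
ancestors T@(node l v r) S =
  if does (nonempty? (S ∩ keys T))
    then ⁅ v ⁆ ∪ (ancestors l S ∪ ancestors r S)
    else ⊥

-- The node set of the minimal subtree (connected part) of T containing S: its
-- top is the lowest common ancestor of S, and it consists of the paths from
-- there to the nodes of S.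

minimalSubtree : Tree n → Subset n → Subset n
minimalSubtree leaf           S = ⊥
minimalSubtree T@(node l v r) S =
  if does (S ⊆? keys l) then minimalSubtree l S
  else if does (S ⊆? keys r) then minimalSubtree r S
  else ancestors T S

-- An algorithm may look at the current tree, the current query and all later
-- queries; it answers with a sequence of rotations.

Algorithm : ℕ → Set
Algorithm n = (T : Tree n) (x : Fin n) (future : List (Fin n)) →
              ∃ λ T′ → T ⟶* T′

cost : Algorithm n → List (Fin n) → Tree n → ℕ
cost A []       T = 0
cost A (x ∷ xs) T = let T′ , ρs = A T x xs in
  ∣ path x T ∪ minimalSubtree T (rotated ρs) ∣ ℕ.+ cost A xs T′

-- x lies strictly between the predecessor and the successor of v in P, where
-- a missing predecessor is -∞ and a missing successor is +∞.

Between : Subset n → Fin n → Fin n → Set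
Between P v x = ∀ w → w ∈ P → (w < v → w < x) × (v < w → x < w)

between? : (P : Subset n) (v x : Fin n) → Dec (Between P v x)
between? P v x = all? λ w →
  (w ∈? P) →-dec ((w <? v →-dec w <? x) ×-dec (v <? w →-dec x <? w))

-- Times are positions in the remaining sequence. The time +∞ is represented by
-- the length of that sequence, which exceeds all positions in it.

τ : Subset n → List (Fin n) → Fin n → ℕ
τ P []       v = 0
τ P (x ∷ xs) v = if does (between? P v x) then 0 else suc (τ P xs v)

module Treap {n : ℕ} (P : Subset n) (xs : List (Fin n)) where

  _Beats_ : Fin n → Fin n → Set
  u Beats v = u ∈ P × τ P xs u ℕ.< τ P xs v

  beats? : (u v : Fin n) → Dec (u Beats v)
  beats? u v = (u ∈? P) ×-dec (τ P xs u ℕ.<? τ P xs v)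

  -- In sinkˡ l v r, the path nodes of l already form a treap at the top of l,
  -- no node of r is on the path, and v is above all of them in the original
  -- tree, so that it wins ties. Rotating v down as long as a path node with
  -- strictly smaller τ is its child yields the treap that includes v.
  -- Subtrees whose root is not in P are moved as a whole.

  sinkˡ : Tree n → Fin n → Tree n → Tree n
  sinkˡ leaf         v r = node leaf v r
  sinkˡ (node a u b) v r with beats? u v
  ... | yes _ = node a u (sinkˡ b v r)
  ... | no  _ = node (node a u b) v r

  sinkʳ : Tree n → Fin n → Tree n → Tree n
  sinkʳ l v leaf         = node l v leaf
  sinkʳ l v (node a u b) with beats? u v
  ... | yes _ = node (sinkʳ l v a) u b
  ... | no  _ = node l v (node a u b)

  rearrange : Fin n → Tree n → Tree n
  rearrange x leaf = leaf
  rearrange x (node l v r) with <-cmp x v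
  ... | tri< _ _ _ = sinkˡ (rearrange x l) v r
  ... | tri≈ _ _ _ = node l v r
  ... | tri> _ _ _ = sinkʳ l v (rearrange x r)

  sinkˡ-rotations : ∀ l v r → node l v r ⟶* sinkˡ l v r
  sinkˡ-rotations leaf         v r = ε
  sinkˡ-rotations (node a u b) v r with beats? u v
  ... | yes _ = right ◅ gmap (node a u) inʳ (sinkˡ-rotations b v r)
  ... | no  _ = ε

  sinkʳ-rotations : ∀ l v r → node l v r ⟶* sinkʳ l v r
  sinkʳ-rotations l v leaf         = ε
  sinkʳ-rotations l v (node a u b) with beats? u v
  ... | yes _ = left ◅ gmap (λ T → node T u b) inˡ (sinkʳ-rotations l v a)
  ... | no  _ = ε

  rotations : ∀ x T → T ⟶* rearrange x T
  rotations x leaf = ε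
  rotations x (node l v r) with <-cmp x v
  ... | tri< _ _ _ = gmap (λ T → node T v r) inˡ (rotations x l)
                       ◅◅ sinkˡ-rotations (rearrange x l) v r
  ... | tri≈ _ _ _ = ε
  ... | tri> _ _ _ = gmap (node l v) inʳ (rotations x r)
                       ◅◅ sinkʳ-rotations l v (rearrange x r)

GF : Algorithm n
GF T x xs = rearrange x T , rotations x T
  where open Treap (path x T) xs

{-# OPTIONS --safe #-}

-- A gadget of depth d + 1 has keys L < j < c < j′ < R, where L and R are gadgets
-- of depth d. Queries to it cycle through c, L, R, and recursively so within L
-- and R. The clean tree has root c and subtrees L and R; each query made in the
-- order c, L, R leaves it unchanged. The dirty tree has root j′ with left child j,
-- and L, c, R hang off these two keys; it is unchanged by the reversed order
-- R, L, c. In a round of three queries a gadget node contributes 3 to the cost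
-- with the clean tree but 6 with the dirty one, so that the ratio of the costs
-- tends to 2 as d grows.
--
-- All keys of the gadget are chosen on one search path of T₀, to some key y. The
-- query y then rearranges all of them into a treap ordered by their first later
-- query: starting with c, L, R puts the clean tree on top (j and j′ sink), while
-- starting with the reversal of c, L, R, j, j′ puts the dirty tree on top.

module Submission where

open import Data.Bool.Base using (if_then_else_)
open import Data.Fin.Base as Fin using (Fin)
open import Data.Fin.Properties as Fin using (<-cmp)
open import Data.Fin.Subset using (Subset; inside; outside; _∈_; _∉_; _⊆_; ⊥; ⁅_⁆; _∪_; ∣_∣)
open import Data.Fin.Subset.Properties
  using (_⊆?_; ⊥⊆; ∉⊥; x∈⁅x⁆; x∈⁅y⁆⇒x≡y; x∈p∪q⁻; p⊆p∪q; q⊆p∪q; ∪-identityˡ; ∪-identityʳ;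
         ∣⁅x⁆∣≡1; ∣p∣≤n)
open import Data.Integer.Base as ℤ using (+_; -[1+_])
import Data.Integer.Properties as ℤ
import Data.Integer.Tactic.RingSolver as ℤ
open import Data.List.Base using (List; []; _∷_; [_]; _++_; _ʳ++_; allFin; length; map; reverse)
open import Data.List.Membership.Propositional using () renaming (_∈_ to _∈ₗ_)
open import Data.List.Membership.Propositional.Properties using (∈-++⁻; ∈-++⁺ˡ; ∈-++⁺ʳ)
open import Data.List.Properties
  using (++-assoc; ++-identityʳ; length-++; length-tabulate; map-++; reverse-++; unfold-reverse;
         ʳ++-defn; ++-ʳ++)
open import Data.List.Relation.Unary.All as All using (All; []; _∷_)
import Data.List.Relation.Unary.All.Properties as All
open import Data.List.Relation.Unary.AllPairs using (AllPairs; []; _∷_)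
import Data.List.Relation.Unary.AllPairs.Properties as AllPairs
open import Data.List.Relation.Unary.Any using (here; there)
open import Data.Nat.Base as ℕ using (ℕ; zero; suc; z≤n; s≤s; _^_; _≤_)
open import Data.Nat.Coprimality using (Coprime)
open import Data.Nat.ListAction using (sum)
open import Data.Nat.ListAction.Properties using (sum-++)
import Data.Nat.Properties as ℕ
open import Data.Nat.Tactic.RingSolver using (solve-∀)
open import Data.Product.Base using (∃; Σ-syntax; _×_; _,_; proj₁; proj₂)
open import Data.Rational.Base as ℚ using (ℚ; mkℚ; 0ℚ; _/_; _-_; _*_; _<_; _≥_; *<*; toℚᵘ)
import Data.Rational.Properties as ℚ
open import Data.Rational.Unnormalised.Base as ℚᵘ using (mkℚᵘ; *≤*)
import Data.Rational.Unnormalised.Properties as ℚᵘ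
open import Data.Sum.Base using (_⊎_; inj₁; inj₂; [_,_]′)
open import Data.Unit.Base using (⊤; tt)
open import Data.Vec.Base using (_∷_; here; there)
open import Function.Base using (_∘_; case_of_; id)
open import Relation.Binary.Construct.Closure.ReflexiveTransitive as Star
  using (_◅_; _◅◅_; gmap)
open import Relation.Binary.Definitions using (tri<; tri≈; tri>)
open import Relation.Binary.PropositionalEquality hiding ([_])
open import Relation.Nullary using (¬_; contradiction; yes; no)
open import Relation.Nullary.Decidable using (True; toWitness; dec-true; dec-false)
open import Defs

-- In the reversed rounds `j` and `j′` are never asked again, yet they stay on top: τ of a path key
-- refers to every query between its path neighbours, and in the order R, L, c the coming queries
-- hit the intervals of `j′` and `j` no later than those of the keys below them. Ties favour the
-- upper node, so nothing moves. The obstacle is the dependence on the future. Whether a parent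
-- stays above its child is decided by the next query to its subgadget, which lies further ahead the
-- deeper the subgadget is; a lookahead of 5^d queries suffices at all levels. Near the end of the
-- sequence this control is lost. Hence further rounds serve as a buffer after those that are
-- counted; the buffer and everything after it are charged n per query in the upper bound and
-- dropped in the lower one. This overhead does not depend on the number m of counted repetitions,
-- so a large m makes it negligible. The ratio 2 is missed only through the 2^d leaves of the
-- gadget, which cost the same in both trees. Their share in the clean cost is at most 1/(d + 1),
-- which fixes the depth in terms of ε.

private
  variable
    n d k : ℕ
    a b u v w x y : Fin n
    l l′ r r′ T T′ Σ₀ : Tree n
    as bs ls rs us vs xs ys zs : List (Fin n)
    A B S : Fin n → Set

-- Ordered trees and search paths

infix 4 _∈ᵗ_

data _∈ᵗ_ {n : ℕ} (w : Fin n) : Tree n → Set where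
  left  : w ∈ᵗ l → w ∈ᵗ node l v r
  root  : w ∈ᵗ node l w r
  right : w ∈ᵗ r → w ∈ᵗ node l v r

∈ᵗ⇒∈ : w ∈ᵗ T → w ∈ₗ inorder T
∈ᵗ⇒∈ (left w∈)          = ∈-++⁺ˡ (∈ᵗ⇒∈ w∈)
∈ᵗ⇒∈ (root {l = l})     = ∈-++⁺ʳ (inorder l) (here refl)
∈ᵗ⇒∈ (right {l = l} w∈) = ∈-++⁺ʳ (inorder l) (there (∈ᵗ⇒∈ w∈))

∈⇒∈ᵗ : ∀ T → w ∈ₗ inorder T → w ∈ᵗ T
∈⇒∈ᵗ (node l v r) w∈ with ∈-++⁻ (inorder l) w∈
... | inj₁ p            = left (∈⇒∈ᵗ l p)
... | inj₂ (here refl)  = root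
... | inj₂ (there p)    = right (∈⇒∈ᵗ r p)

<-irrefl : ∀ {v : Fin n} → ¬ v Fin.< v
<-irrefl {v = v} = Fin.<-irrefl (refl {x = v})

<-asym : ∀ {u v : Fin n} → u Fin.< v → ¬ v Fin.< u
<-asym {u = u} {v = v} = Fin.<-asym {x = u} {v}

data Ordered {n : ℕ} : Tree n → Set where
  leaf : Ordered leaf
  node : Ordered l → Ordered r →
         (∀ {w} → w ∈ᵗ l → w Fin.< v) → (∀ {w} → w ∈ᵗ r → v Fin.< w) →
         Ordered (node l v r)

AllPairs-++⁻ : ∀ {R : Fin n → Fin n → Set} xs → AllPairs R (xs ++ ys) →
               AllPairs R xs × AllPairs R ys × (∀ {x y} → x ∈ₗ xs → y ∈ₗ ys → R x y)
AllPairs-++⁻ []       ps       = [] , ps , λ ()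
AllPairs-++⁻ (x ∷ xs) (p ∷ ps) with AllPairs-++⁻ xs ps
... | ps₁ , ps₂ , ps₁₂ = All.++⁻ˡ xs p ∷ ps₁ , ps₂ , λ where
  (here refl) y∈ → All.lookup (All.++⁻ʳ xs p) y∈
  (there x∈)  y∈ → ps₁₂ x∈ y∈

ordered⁺ : (T : Tree n) → AllPairs Fin._<_ (inorder T) → Ordered T
ordered⁺ leaf         _  = leaf
ordered⁺ (node l v r) ps with AllPairs-++⁻ (inorder l) ps
... | psˡ , p ∷ psʳ , lt =
  node (ordered⁺ l psˡ) (ordered⁺ r psʳ) (λ w∈ → lt (∈ᵗ⇒∈ w∈) (here refl)) (All.lookup p ∘ ∈ᵗ⇒∈)

∈-left⁻ : Ordered (node l v r) → w ∈ᵗ node l v r → w Fin.< v → w ∈ᵗ l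
∈-left⁻ (node _ _ _ >v) (left w∈)  _   = w∈
∈-left⁻ (node _ _ _ >v) root       w<v = contradiction w<v <-irrefl
∈-left⁻ (node _ _ _ >v) (right w∈) w<v = contradiction (>v w∈) (<-asym w<v)

∈-right⁻ : Ordered (node l v r) → w ∈ᵗ node l v r → v Fin.< w → w ∈ᵗ r
∈-right⁻ (node _ _ <v _) (left w∈)  v<w = contradiction (<v w∈) (<-asym v<w)
∈-right⁻ (node _ _ <v _) root       v<w = contradiction v<w <-irrefl
∈-right⁻ (node _ _ <v _) (right w∈) _   = w∈

path-< : x Fin.< v → path x (node l v r) ≡ ⁅ v ⁆ ∪ path x l
path-< {x = x} {v = v} x<v with <-cmp x v
... | tri< _ _ _   = refl
... | tri≈ x≮v _ _ = contradiction x<v x≮v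
... | tri> x≮v _ _ = contradiction x<v x≮v

path-≡ : ∀ l (v : Fin n) r → path v (node l v r) ≡ ⁅ v ⁆
path-≡ _ v _ with <-cmp v v
... | tri< _ v≢v _ = contradiction refl v≢v
... | tri≈ _ _ _   = refl
... | tri> _ v≢v _ = contradiction refl v≢v

path-> : v Fin.< x → path x (node l v r) ≡ ⁅ v ⁆ ∪ path x r
path-> {v = v} {x = x} v<x with <-cmp x v
... | tri< _ _ v≮x = contradiction v<x v≮x
... | tri≈ _ _ v≮x = contradiction v<x v≮x
... | tri> _ _ _   = refl

∈-∪⁻ : ∀ {p} → w ∈ ⁅ v ⁆ ∪ p → w ≡ v ⊎ w ∈ p
∈-∪⁻ {p = p} w∈ with x∈p∪q⁻ _ p w∈
... | inj₁ w∈v = inj₁ (x∈⁅y⁆⇒x≡y _ w∈v)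
... | inj₂ w∈p = inj₂ w∈p

∈-path⇒∈ᵗ : (T : Tree n) → w ∈ path x T → w ∈ᵗ T
∈-path⇒∈ᵗ leaf w∈ = contradiction w∈ ∉⊥
∈-path⇒∈ᵗ {x = x} (node l v r) w∈ with <-cmp x v
... | tri< _ _ _ = [ (λ where refl → root) , left ∘ ∈-path⇒∈ᵗ l ]′ (∈-∪⁻ w∈)
... | tri≈ _ _ _ = case x∈⁅y⁆⇒x≡y v w∈ of λ where refl → root
... | tri> _ _ _ = [ (λ where refl → root) , right ∘ ∈-path⇒∈ᵗ r ]′ (∈-∪⁻ w∈)

-- The elements of A in xs are, in this order, those of ys, as far as ys
-- reaches; up to there xs has elements of S only.
data Follows {n : ℕ} (S A : Fin n → Set) : (ys xs : List (Fin n)) → Set where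
  stop : Follows S A [] xs
  skip : S x → ¬ A x → Follows S A ys xs → Follows S A ys (x ∷ xs)
  hit  : S x → A x → Follows S A ys xs → Follows S A (x ∷ ys) (x ∷ xs)

follows-∈ : Follows S A (a ∷ ys) xs → A a
follows-∈ (skip _ _ f)  = follows-∈ f
follows-∈ (hit _ a∈A _) = a∈A

-- Comparing the first hits of two intervals

module _ {P : Subset n} where

  τ-hit : Between P v x → τ P (x ∷ xs) v ≡ 0
  τ-hit {v = v} {x = x} {xs = xs} b =
    cong (if_then 0 else suc (τ P xs v)) (dec-true (between? P v x) b)

  τ-miss : ¬ Between P v x → τ P (x ∷ xs) v ≡ suc (τ P xs v)
  τ-miss {v = v} {x = x} {xs = xs} ¬b =
    cong (if_then 0 else suc (τ P xs v)) (dec-false (between? P v x) ¬b)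

  -- `a` is the first query in `A`. It hits the interval of `v`, while every earlier query lies
  -- outside `A` and so misses the interval of `u`.
  τ-mono-≤ : Follows S A (a ∷ ys) xs → Between P v a →
             (∀ {x} → S x → Between P u x → A x) → τ P xs v ≤ τ P xs u
  τ-mono-≤ {v = v} (hit {xs = xs} _ _ _) va _ = ℕ.≤-trans (ℕ.≤-reflexive (τ-hit {xs = xs} va)) z≤n
  τ-mono-≤ {v = v} {u = u} (skip {x = x} {xs = xs} x∈S x∉A f) va u⊆A =
    case between? P v x of λ where
      (yes vx) → ℕ.≤-trans (ℕ.≤-reflexive (τ-hit {xs = xs} vx)) z≤n
      (no ¬vx) → subst₂ ℕ._≤_ (sym (τ-miss {xs = xs} ¬vx))
                   (sym (τ-miss {xs = xs} (x∉A ∘ u⊆A x∈S))) (s≤s (τ-mono-≤ f va u⊆A))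

  -- Strictness comes from `a` itself, which also misses the interval of `u`.
  τ-mono-< : Follows S A (a ∷ ys) xs → Between P v a →
             (∀ {x} → S x → Between P u x → A x × x ≢ a) → τ P xs v ℕ.< τ P xs u
  τ-mono-< (hit {xs = xs} a∈S _ _) va u⊆A =
    subst₂ ℕ._<_ (sym (τ-hit {xs = xs} va))
      (sym (τ-miss {xs = xs} λ ux → proj₂ (u⊆A a∈S ux) refl)) (s≤s z≤n)
  τ-mono-< {v = v} {u = u} (skip {x = x} {xs = xs} x∈S x∉A f) va u⊆A =
    subst (τ P (x ∷ xs) v ℕ.<_) (sym (τ-miss {xs = xs} λ ux → x∉A (proj₁ (u⊆A x∈S ux))))
      (case between? P v x of λ where
        (yes vx) → subst (ℕ._< _) (sym (τ-hit {xs = xs} vx)) (s≤s z≤n)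
        (no ¬vx) → subst (ℕ._< _) (sym (τ-miss {xs = xs} ¬vx)) (s≤s (τ-mono-< f va u⊆A)))

-- Trees left unchanged by a query

-- Arbitrary subtrees may replace the leaves of the first tree. They hold the keys outside the
-- gadget, whose arrangement stays unspecified.
data Top {n : ℕ} : Tree n → Tree n → Set where
  leaf : Top leaf T
  node : Top l l′ → Top r r′ → Top (node l v r) (node l′ v r′)

-- The query x, followed by xs, does not change a tree with top Σ: whenever the
-- path to x leaves v, the first query below v hits the interval of v.
data Calm {n : ℕ} (S : Fin n → Set) (xs : List (Fin n)) : Tree n → Fin n → Set where
  here : Calm S xs (node l v r) v
  goˡ  : x Fin.< v → Follows S (_∈ᵗ node l v r) (a ∷ ys) xs →
         (∀ {w} → w ∈ path x l → w Fin.< a) → Calm S xs l x → Calm S xs (node l v r) x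
  goʳ  : v Fin.< x → Follows S (_∈ᵗ node l v r) (a ∷ ys) xs →
         (∀ {w} → w ∈ path x r → a Fin.< w) → Calm S xs r x → Calm S xs (node l v r) x

calm-path : Calm S xs Σ₀ x → Top Σ₀ T → path x T ≡ path x Σ₀
calm-path (here {l = l} {v} {r}) (node {l′ = l′} {r′ = r′} _ _) = trans (path-≡ l′ v r′) (sym (path-≡ l v r))
calm-path (goˡ x<v _ _ c) (node tl _)  =
  trans (path-< x<v) (trans (cong (_ ∪_) (calm-path c tl)) (sym (path-< x<v)))
calm-path (goʳ v<x _ _ c) (node _ tr)  =
  trans (path-> v<x) (trans (cong (_ ∪_) (calm-path c tr)) (sym (path-> v<x)))

-- The tree is kept together with its rotations because the cost depends on the rotated edges: an
-- unchanged tree must also come with the empty rotation sequence.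
Rotation : Tree n → Set
Rotation T = ∃ λ T′ → T ⟶* T′

module Calmness (P : Subset n) (S : Fin n → Set) (xs : List (Fin n)) where

  open Treap P xs

  rotation : ∀ x T → Rotation T
  rotation x T = rearrange x T , rotations x T

  sunkˡ : ∀ l v r → Rotation (node l v r)
  sunkˡ l v r = sinkˡ l v r , sinkˡ-rotations l v r

  sunkʳ : ∀ l v r → Rotation (node l v r)
  sunkʳ l v r = sinkʳ l v r , sinkʳ-rotations l v r

  rotation-< : x Fin.< v → rotation x l ≡ (l , Star.ε) →
               rotation x (node l v r) ≡ sunkˡ l v r
  rotation-< {x = x} {v = v} {l = l} {r = r} x<v eq with <-cmp x v
  ... | tri< _ _ _   = cong f eq
    where
    f : Rotation l → Rotation (node l v r)
    f (l′ , ρ) = sinkˡ l′ v r , gmap (λ T → node T v r) inˡ ρ ◅◅ sinkˡ-rotations l′ v r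
  ... | tri≈ x≮v _ _ = contradiction x<v x≮v
  ... | tri> x≮v _ _ = contradiction x<v x≮v

  rotation-> : v Fin.< x → rotation x r ≡ (r , Star.ε) →
               rotation x (node l v r) ≡ sunkʳ l v r
  rotation-> {v = v} {x = x} {r = r} {l = l} v<x eq with <-cmp x v
  ... | tri< _ _ v≮x = contradiction v<x v≮x
  ... | tri≈ _ _ v≮x = contradiction v<x v≮x
  ... | tri> _ _ _   = cong f eq
    where
    f : Rotation r → Rotation (node l v r)
    f (r′ , ρ) = sinkʳ l v r′ , gmap (node l v) inʳ ρ ◅◅ sinkʳ-rotations l v r′

  rotation-≡ : rotation v (node l v r) ≡ (node l v r , Star.ε)
  rotation-≡ {v = v} with <-cmp v v
  ... | tri< _ v≢v _ = contradiction refl v≢v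
  ... | tri≈ _ _ _   = refl
  ... | tri> _ v≢v _ = contradiction refl v≢v

  stuckˡ : ¬ (u Beats v) → sunkˡ (node l u l′) v r ≡ (node (node l u l′) v r , Star.ε)
  stuckˡ {u = u} {v = v} ¬b with beats? u v
  ... | yes b = contradiction b ¬b
  ... | no _  = refl

  stuckʳ : ¬ (u Beats v) → sunkʳ l v (node r u r′) ≡ (node l v (node r u r′) , Star.ε)
  stuckʳ {u = u} {v = v} ¬b with beats? u v
  ... | yes b = contradiction b ¬b
  ... | no _  = refl

  -- The induction descends into subtrees of the top, while `P` remains the path in the whole tree.
  -- The last two hypotheses localise `P`: a query in the interval of a key of `Σ₀` belongs to `Σ₀`,
  -- and a path key off the local path lies entirely to one side of `Σ₀`. Then the interval of each
  -- `v` on the path is hit no later than that of its child, and `v` does not sink.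
  calm-rotation :
    Ordered Σ₀ → Top Σ₀ T → Calm S xs Σ₀ x → path x Σ₀ ⊆ P →
    (∀ {u x} → u ∈ᵗ Σ₀ → S x → Between P u x → x ∈ᵗ Σ₀) →
    (∀ {w} → w ∈ P → w ∈ path x Σ₀ ⊎ (∀ {u} → u ∈ᵗ Σ₀ → w Fin.< u) ⊎ (∀ {u} → u ∈ᵗ Σ₀ → u Fin.< w)) →
    rotation x T ≡ (T , Star.ε)
  calm-rotation _ (node _ _) here _ _ _ = rotation-≡
  calm-rotation {Σ₀ = node l v r} o@(node ol or <v >v) (node {l′ = l′} tl tr)
                (goˡ {x = x} {a = a} x<v f path<a c) path⊆P iso sep =
    trans (rotation-< x<v (calm-rotation ol tl c (path⊆P ∘ path-ˡ) iso-ˡ sep-ˡ)) (top-stuck tl c)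
    where
    path-ˡ : path x l ⊆ path x (node l v r)
    path-ˡ w∈ = subst (_ ∈_) (sym (path-< x<v)) (q⊆p∪q ⁅ v ⁆ _ w∈)

    v∈P : v ∈ P
    v∈P = path⊆P (subst (v ∈_) (sym (path-< x<v)) (p⊆p∪q _ (x∈⁅x⁆ v)))

    on-path : w ∈ path x (node l v r) → w ≡ v ⊎ w ∈ path x l
    on-path w∈ = ∈-∪⁻ (subst (_ ∈_) (path-< x<v) w∈)

    iso-ˡ : ∀ {u x} → u ∈ᵗ l → S x → Between P u x → x ∈ᵗ l
    iso-ˡ u∈ x∈S b = ∈-left⁻ o (iso (left u∈) x∈S b) (proj₂ (b v v∈P) (<v u∈))

    sep-ˡ : ∀ {w} → w ∈ P → w ∈ path x l ⊎ (∀ {u} → u ∈ᵗ l → w Fin.< u) ⊎ (∀ {u} → u ∈ᵗ l → u Fin.< w)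
    sep-ˡ w∈P with sep w∈P
    ... | inj₂ (inj₁ w<) = inj₂ (inj₁ (w< ∘ left))
    ... | inj₂ (inj₂ <w) = inj₂ (inj₂ (<w ∘ left))
    ... | inj₁ w∈path with on-path w∈path
    ...   | inj₁ refl = inj₂ (inj₂ <v)
    ...   | inj₂ w∈   = inj₁ w∈

    between-a : Between P v a
    between-a w w∈P with sep w∈P
    ... | inj₂ (inj₁ w<) = (λ _ → w< (follows-∈ f)) , λ v<w → contradiction (w< (root)) (<-asym v<w)
    ... | inj₂ (inj₂ <w) = (λ w<v → contradiction (<w (root)) (<-asym w<v)) , λ _ → <w (follows-∈ f)
    ... | inj₁ w∈path with on-path w∈path
    ...   | inj₁ refl = (λ v<v → contradiction v<v <-irrefl) , λ v<v → contradiction v<v <-irrefl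
    ...   | inj₂ w∈   = (λ _ → path<a w∈) , λ v<w → contradiction (<v (∈-path⇒∈ᵗ l w∈)) (<-asym v<w)

    top-stuck : ∀ {l′ r₀} → Top l l′ → Calm S xs l x →
                sunkˡ l′ v r₀ ≡ (node l′ v r₀ , Star.ε)
    top-stuck (node _ _) _ = stuckˡ λ where
      -- A hit of the child's interval is a query in `Σ₀`, and the first of these, `a`, already hits
      -- the interval of `v`.
      (_ , τu<τv) → ℕ.<⇒≱ τu<τv
        (τ-mono-≤ f between-a λ x∈S b → iso (left (root)) x∈S b)
  calm-rotation {Σ₀ = node l v r} o@(node ol or <v >v) (node {l′ = l′} tl tr)
                (goʳ {x = x} {a = a} v<x f a<path c) path⊆P iso sep =
    trans (rotation-> v<x (calm-rotation or tr c (path⊆P ∘ path-ʳ) iso-ʳ sep-ʳ)) (top-stuck tr c)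
    where
    path-ʳ : path x r ⊆ path x (node l v r)
    path-ʳ w∈ = subst (_ ∈_) (sym (path-> v<x)) (q⊆p∪q ⁅ v ⁆ _ w∈)

    v∈P : v ∈ P
    v∈P = path⊆P (subst (v ∈_) (sym (path-> v<x)) (p⊆p∪q _ (x∈⁅x⁆ v)))

    on-path : w ∈ path x (node l v r) → w ≡ v ⊎ w ∈ path x r
    on-path w∈ = ∈-∪⁻ (subst (_ ∈_) (path-> v<x) w∈)

    iso-ʳ : ∀ {u x} → u ∈ᵗ r → S x → Between P u x → x ∈ᵗ r
    iso-ʳ u∈ x∈S b = ∈-right⁻ o (iso (right u∈) x∈S b) (proj₁ (b v v∈P) (>v u∈))

    sep-ʳ : ∀ {w} → w ∈ P → w ∈ path x r ⊎ (∀ {u} → u ∈ᵗ r → w Fin.< u) ⊎ (∀ {u} → u ∈ᵗ r → u Fin.< w)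
    sep-ʳ w∈P with sep w∈P
    ... | inj₂ (inj₁ w<) = inj₂ (inj₁ (w< ∘ right))
    ... | inj₂ (inj₂ <w) = inj₂ (inj₂ (<w ∘ right))
    ... | inj₁ w∈path with on-path w∈path
    ...   | inj₁ refl = inj₂ (inj₁ >v)
    ...   | inj₂ w∈   = inj₁ w∈

    between-a : Between P v a
    between-a w w∈P with sep w∈P
    ... | inj₂ (inj₁ w<) = (λ _ → w< (follows-∈ f)) , λ v<w → contradiction (w< (root)) (<-asym v<w)
    ... | inj₂ (inj₂ <w) = (λ w<v → contradiction (<w (root)) (<-asym w<v)) , λ _ → <w (follows-∈ f)
    ... | inj₁ w∈path with on-path w∈path
    ...   | inj₁ refl = (λ v<v → contradiction v<v <-irrefl) , λ v<v → contradiction v<v <-irrefl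
    ...   | inj₂ w∈   = (λ w<v → contradiction (>v (∈-path⇒∈ᵗ r w∈)) (<-asym w<v)) , λ _ → a<path w∈

    top-stuck : ∀ {l₀ r′} → Top r r′ → Calm S xs r x →
                sunkʳ l₀ v r′ ≡ (node l₀ v r′ , Star.ε)
    top-stuck (node _ _) _ = stuckʳ λ where
      (_ , τu<τv) → ℕ.<⇒≱ τu<τv
        (τ-mono-≤ f between-a λ x∈S b → iso (right (root)) x∈S b)

-- The empty set lies in every left subtree, so the search for its top descends to a leaf.
minimalSubtree-⊥ : (T : Tree n) → minimalSubtree T ⊥ ≡ ⊥
minimalSubtree-⊥ leaf         = refl
minimalSubtree-⊥ (node l v r)
  rewrite dec-true (⊥ ⊆? keys l) ⊥⊆ = minimalSubtree-⊥ l

depth : Tree n → Fin n → ℕ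
depth T x = ∣ path x T ∣

GF-calm : Ordered Σ₀ → Top Σ₀ T → Calm (_∈ᵗ Σ₀) xs Σ₀ x → GF T x xs ≡ (T , Star.ε)
GF-calm {Σ₀ = Σ₀} {T = T} {xs = xs} {x = x} o t c =
  Calmness.calm-rotation (path x T) (_∈ᵗ Σ₀) xs o t c
    (subst (_ ∈_) (sym (calm-path c t))) (λ _ x∈S _ → x∈S)
    (inj₁ ∘ subst (_ ∈_) (calm-path c t))

-- Only the queries of the first list are calm; the second list is the future that they look into.
data Calms {n : ℕ} (Σ₀ : Tree n) : (xs post : List (Fin n)) → Set where
  []  : Calms Σ₀ [] ys
  _∷_ : Calm (_∈ᵗ Σ₀) (xs ++ ys) Σ₀ x → Calms Σ₀ xs ys → Calms Σ₀ (x ∷ xs) ys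

total : (Fin n → ℕ) → List (Fin n) → ℕ
total h xs = sum (map h xs)

cost-static : (𝒜 : Algorithm n) (xs : List (Fin n)) → 𝒜 T x xs ≡ (T , Star.ε) →
              cost 𝒜 (x ∷ xs) T ≡ depth T x ℕ.+ cost 𝒜 xs T
cost-static {T = T} {x = x} 𝒜 xs eq
  rewrite eq | minimalSubtree-⊥ T | ∪-identityʳ (path x T) = refl

cost-calms : Ordered Σ₀ → Top Σ₀ T → Calms Σ₀ xs ys →
             cost GF (xs ++ ys) T ≡ total (depth Σ₀) xs ℕ.+ cost GF ys T
cost-calms o t [] = refl
cost-calms {Σ₀ = Σ₀} {T = T} {xs = x ∷ xs} {ys = ys} o t (c ∷ cs) = begin
  cost GF (x ∷ xs ++ ys) T                                 ≡⟨ cost-static GF (xs ++ ys) (GF-calm o t c) ⟩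
  depth T x ℕ.+ cost GF (xs ++ ys) T
    ≡⟨ cong₂ ℕ._+_ (cong ∣_∣ (calm-path c t)) (cost-calms o t cs) ⟩
  depth Σ₀ x ℕ.+ (total (depth Σ₀) xs ℕ.+ cost GF ys T)    ≡⟨ ℕ.+-assoc (depth Σ₀ x) _ _ ⟨
  depth Σ₀ x ℕ.+ total (depth Σ₀) xs ℕ.+ cost GF ys T      ∎
  where open ≡-Reasoning

-- The treap built by the first query

⟶-inorder : T ⟶ T′ → inorder T ≡ inorder T′
⟶-inorder (right {a = a} {b = b})     = ++-assoc (inorder a) _ _
⟶-inorder (left {a = a})              = sym (++-assoc (inorder a) _ _)
⟶-inorder (inˡ {v = v} {r = r} ρ)     = cong (_++ v ∷ inorder r) (⟶-inorder ρ)
⟶-inorder (inʳ {l = l} {v = v} ρ)     = cong (λ ws → inorder l ++ v ∷ ws) (⟶-inorder ρ)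

⟶*-inorder : T ⟶* T′ → inorder T ≡ inorder T′
⟶*-inorder Star.ε        = refl
⟶*-inorder (ρ ◅ ρs) = trans (⟶-inorder ρ) (⟶*-inorder ρs)

⟶*-∈ : T ⟶* T′ → w ∈ᵗ T′ → w ∈ᵗ T
⟶*-∈ {T = T} ρs = ∈⇒∈ᵗ T ∘ subst (_ ∈ₗ_) (sym (⟶*-inorder ρs)) ∘ ∈ᵗ⇒∈

⟶*-∈⁺ : T ⟶* T′ → w ∈ᵗ T → w ∈ᵗ T′
⟶*-∈⁺ {T′ = T′} ρs = ∈⇒∈ᵗ T′ ∘ subst (_ ∈ₗ_) (⟶*-inorder ρs) ∘ ∈ᵗ⇒∈

-- Every subtree is rooted at the one of its keys that is queried first.
data Rooted {n : ℕ} (S : Fin n → Set) (xs : List (Fin n)) : Tree n → Set where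
  leaf : Rooted S xs leaf
  node : Follows S (_∈ᵗ node l v r) (v ∷ ys) xs → Rooted S xs l → Rooted S xs r →
         Rooted S xs (node l v r)

module Heap (P : Subset n) (xs : List (Fin n)) where

  open Treap P xs

  -- Heap order is imposed on path keys only; `off` covers the subtrees hanging off the path, which
  -- are moved as a whole.
  data Heaped : Tree n → Set where
    off : (∀ {w} → w ∈ᵗ T → w ∉ P) → Heaped T
    on  : v ∈ P → Heaped l → Heaped r →
          (∀ {w} → w ∈ᵗ l → w ∈ P → τ P xs v ≤ τ P xs w) →
          (∀ {w} → w ∈ᵗ r → w ∈ P → τ P xs v ≤ τ P xs w) →
          Heaped (node l v r)

  -- This is insertion into a heap: a child that beats `v` remains above it, and a path child that
  -- does not beat `v` passes its lower bound on τ to everything under it.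
  sinkˡ-heaped : ∀ l → Heaped l → v ∈ P → (∀ {w} → w ∈ᵗ r → w ∉ P) → Heaped (sinkˡ l v r)
  sinkˡ-heaped leaf hl v∈P r∉P = on v∈P hl (off r∉P) (λ ()) λ w∈ w∈P → contradiction w∈P (r∉P w∈)
  sinkˡ-heaped {v = v} {r = r} (node a u b) hl v∈P r∉P with beats? u v | hl
  ... | yes (u∈P , _) | off ∉P = contradiction u∈P (∉P root)
  ... | yes (u∈P , τu<τv) | on _ ha hb u≤a u≤b =
    on u∈P ha (sinkˡ-heaped b hb v∈P r∉P) u≤a λ w∈ w∈P →
      case ⟶*-∈ (sinkˡ-rotations b v r) w∈ of λ where
        (left w∈b)  → u≤b w∈b w∈P
        root        → ℕ.<⇒≤ τu<τv
        (right w∈r) → contradiction w∈P (r∉P w∈r)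
  ... | no _  | off ∉P =
    on v∈P (off ∉P) (off r∉P) (λ w∈ w∈P → contradiction w∈P (∉P w∈))
      λ w∈ w∈P → contradiction w∈P (r∉P w∈)
  ... | no ¬b | hl′@(on u∈P _ _ u≤a u≤b) =
    on v∈P hl′ (off r∉P)
      (λ w∈ w∈P → ℕ.≤-trans (ℕ.≮⇒≥ (¬b ∘ (u∈P ,_))) (case w∈ of λ where
        (left w∈a)  → u≤a w∈a w∈P
        root        → ℕ.≤-refl
        (right w∈b) → u≤b w∈b w∈P))
      λ w∈ w∈P → contradiction w∈P (r∉P w∈)

  sinkʳ-heaped : ∀ r → Heaped r → v ∈ P → (∀ {w} → w ∈ᵗ l → w ∉ P) → Heaped (sinkʳ l v r)
  sinkʳ-heaped leaf hr v∈P l∉P = on v∈P (off l∉P) hr (λ w∈ w∈P → contradiction w∈P (l∉P w∈)) λ ()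
  sinkʳ-heaped {v = v} {l = l} (node a u b) hr v∈P l∉P with beats? u v | hr
  ... | yes (u∈P , _) | off ∉P = contradiction u∈P (∉P root)
  ... | yes (u∈P , τu<τv) | on _ ha hb u≤a u≤b =
    on u∈P (sinkʳ-heaped a ha v∈P l∉P) hb
      (λ w∈ w∈P → case ⟶*-∈ (sinkʳ-rotations l v a) w∈ of λ where
        (left w∈l)  → contradiction w∈P (l∉P w∈l)
        root        → ℕ.<⇒≤ τu<τv
        (right w∈a) → u≤a w∈a w∈P)
      u≤b
  ... | no _  | off ∉P =
    on v∈P (off l∉P) (off ∉P) (λ w∈ w∈P → contradiction w∈P (l∉P w∈))
      λ w∈ w∈P → contradiction w∈P (∉P w∈)
  ... | no ¬b | hr′@(on u∈P _ _ u≤a u≤b) =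
    on v∈P (off l∉P) hr′ (λ w∈ w∈P → contradiction w∈P (l∉P w∈))
      λ w∈ w∈P → ℕ.≤-trans (ℕ.≮⇒≥ (¬b ∘ (u∈P ,_))) (case w∈ of λ where
        (left w∈a)  → u≤a w∈a w∈P
        root        → ℕ.≤-refl
        (right w∈b) → u≤b w∈b w∈P)

  rearrange-heaped : ∀ x T → Ordered T → (∀ {w} → w ∈ᵗ T → w ∈ P → w ∈ path x T) →
                     path x T ⊆ P → Heaped (rearrange x T)
  rearrange-heaped x leaf _ _ _ = off λ ()
  rearrange-heaped x (node l v r) (node ol or <v >v) P⊆path path⊆P with <-cmp x v
  ... | tri< _ _ _ = sinkˡ-heaped (rearrange x l)
    (rearrange-heaped x l ol
      (λ w∈ w∈P → case ∈-∪⁻ (P⊆path (left w∈) w∈P) of λ where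
        (inj₁ refl) → contradiction (<v w∈) <-irrefl
        (inj₂ w∈)   → w∈)
      (path⊆P ∘ q⊆p∪q ⁅ v ⁆ _))
    (path⊆P (p⊆p∪q _ (x∈⁅x⁆ v)))
    λ w∈ w∈P → case ∈-∪⁻ (P⊆path (right w∈) w∈P) of λ where
      (inj₁ refl) → <-irrefl (>v w∈)
      (inj₂ w∈l)  → <-asym (>v w∈) (<v (∈-path⇒∈ᵗ l w∈l))
  ... | tri≈ _ _ _ = on (path⊆P (x∈⁅x⁆ v)) (off l∉P) (off r∉P)
    (λ w∈ w∈P → contradiction w∈P (l∉P w∈)) λ w∈ w∈P → contradiction w∈P (r∉P w∈)
    where
    l∉P : ∀ {w} → w ∈ᵗ l → w ∉ P
    l∉P w∈ w∈P = case x∈⁅y⁆⇒x≡y v (P⊆path (left w∈) w∈P) of λ where refl → <-irrefl (<v w∈)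
    r∉P : ∀ {w} → w ∈ᵗ r → w ∉ P
    r∉P w∈ w∈P = case x∈⁅y⁆⇒x≡y v (P⊆path (right w∈) w∈P) of λ where refl → <-irrefl (>v w∈)
  ... | tri> _ _ _ = sinkʳ-heaped (rearrange x r)
    (rearrange-heaped x r or
      (λ w∈ w∈P → case ∈-∪⁻ (P⊆path (right w∈) w∈P) of λ where
        (inj₁ refl) → contradiction (>v w∈) <-irrefl
        (inj₂ w∈)   → w∈)
      (path⊆P ∘ q⊆p∪q ⁅ v ⁆ _))
    (path⊆P (p⊆p∪q _ (x∈⁅x⁆ v)))
    λ w∈ w∈P → case ∈-∪⁻ (P⊆path (left w∈) w∈P) of λ where
      (inj₁ refl) → <-irrefl (<v w∈)
      (inj₂ w∈r)  → <-asym (<v w∈) (>v (∈-path⇒∈ᵗ r w∈r))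

  between-self : Between P v v
  between-self _ _ = id , id

  -- A query `x` on the path separates itself from every other path key. So, while the queries are
  -- path keys, τ of a path key is the time of its own next query.
  between-≡ : x ∈ P → Between P u x → x ≡ u
  between-≡ {x = x} {u = u} x∈P b with <-cmp x u
  ... | tri< x<u _ _ = contradiction (proj₁ (b x x∈P) x<u) <-irrefl
  ... | tri≈ _ x≡u _ = x≡u
  ... | tri> _ _ u<x = contradiction (proj₂ (b x x∈P) u<x) <-irrefl

  -- The root `v` of `Σ₀` is the first key of `Σ₀` to be queried, so its τ is strictly smaller than
  -- that of any other key of `T`. A different root of `T` would violate heap order against `v`.
  -- With equal roots, order splits the keys of `Σ₀` and `T` alike, and the argument recurs on both
  -- sides.
  rooted-top : (∀ {w} → S w → w ∈ P) → Ordered T → Heaped T → Ordered Σ₀ → Rooted S xs Σ₀ →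
               (∀ {w} → w ∈ᵗ Σ₀ → S w) → (∀ {w} → w ∈ᵗ Σ₀ → w ∈ᵗ T) →
               (∀ {w} → w ∈ᵗ T → S w → w ∈ᵗ Σ₀) → Top Σ₀ T
  rooted-top _ _ _ _ leaf _ _ _ = leaf
  rooted-top {S = S} S⊆P oT hT oΣ@(node ol or <v >v) (node {v = v} f rl rr) Σ⊆S Σ⊆T T⊆Σ =
    go oT hT (Σ⊆T root) Σ⊆T T⊆Σ
    where
    dominates : u ≢ v → (S u → u ∈ᵗ node _ v _) → τ P xs v ℕ.< τ P xs u
    dominates u≢v u∈Σ = τ-mono-< f between-self λ x∈S b → case between-≡ (S⊆P x∈S) b of λ where
      refl → u∈Σ x∈S , u≢v
    go : Ordered T → Heaped T → v ∈ᵗ T → (∀ {w} → w ∈ᵗ node _ v _ → w ∈ᵗ T) →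
         (∀ {w} → w ∈ᵗ T → S w → w ∈ᵗ node _ v _) → Top (node _ v _) T
    go _ (off ∉P) v∈ _ _ = contradiction (S⊆P (Σ⊆S root)) (∉P v∈)
    go (node _ _ <u _) (on {v = u} _ _ _ u≤ _) (left v∈) _ T⊆Σ =
      contradiction (u≤ v∈ (S⊆P (Σ⊆S root)))
        (ℕ.<⇒≱ (dominates (λ where refl → <-irrefl (<u v∈)) (T⊆Σ root)))
    go (node _ _ _ >u) (on {v = u} _ _ _ _ u≤) (right v∈) _ T⊆Σ =
      contradiction (u≤ v∈ (S⊆P (Σ⊆S root)))
        (ℕ.<⇒≱ (dominates (λ where refl → <-irrefl (>u v∈)) (T⊆Σ root)))
    go oT@(node oa ob <u >u) (on _ ha hb _ _) root Σ⊆T T⊆Σ = node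
      (rooted-top S⊆P oa ha ol rl (Σ⊆S ∘ left) (λ w∈ → ∈-left⁻ oT (Σ⊆T (left w∈)) (<v w∈))
        λ w∈ w∈S → ∈-left⁻ oΣ (T⊆Σ (left w∈) w∈S) (<u w∈))
      (rooted-top S⊆P ob hb or rr (Σ⊆S ∘ right) (λ w∈ → ∈-right⁻ oT (Σ⊆T (right w∈)) (>v w∈))
        λ w∈ w∈S → ∈-right⁻ oΣ (T⊆Σ (right w∈) w∈S) (>u w∈))

AllPairs-allFin : ∀ n → AllPairs Fin._<_ (allFin n)
AllPairs-allFin n = AllPairs.tabulate⁺-< id

bst-ordered : (T : BST n) → Ordered (tree T)
bst-ordered {n} T = ordered⁺ (tree T) (subst (AllPairs Fin._<_) (sym (ordered T)) (AllPairs-allFin n))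

GF-top : ∀ (T : BST n) y xs → Ordered Σ₀ → (∀ {w} → w ∈ᵗ Σ₀ → w ∈ path y (tree T)) →
         Rooted (_∈ᵗ Σ₀) xs Σ₀ → Top Σ₀ (proj₁ (GF (tree T) y xs))
GF-top {n} T y xs oΣ Σ⊆P rooted =
  rooted-top Σ⊆P
    (ordered⁺ _ (subst (AllPairs Fin._<_) (trans (sym (ordered T)) (⟶*-inorder ρs)) (AllPairs-allFin n)))
    (rearrange-heaped y (tree T) (bst-ordered T) (λ _ → id) id)
    oΣ rooted id (⟶*-∈⁺ ρs ∘ ∈-path⇒∈ᵗ (tree T) ∘ Σ⊆P) (λ _ → id)
  where
  open Heap (path y (tree T)) xs
  ρs : tree T ⟶* proj₁ (GF (tree T) y xs)
  ρs = proj₂ (GF (tree T) y xs)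

-- Interleaved query sequences

data Restricts {n : ℕ} (B : Fin n → Set) : (ls ys : List (Fin n)) → Set where
  []   : Restricts B [] []
  keep : B x → Restricts B ls ys → Restricts B (x ∷ ls) (x ∷ ys)
  drop : ¬ B x → Restricts B ls ys → Restricts B ls (x ∷ ys)

-- Hits outside `B` become skips. This passes the future of a gadget on to its subgadgets.
follows-restrict : (∀ {x} → B x → A x) → Follows S A ys xs → Restricts B ls ys → Follows S B ls xs
follows-restrict B⊆A f                  []           = stop
follows-restrict B⊆A (skip Sx ¬Ax f)    ρ@(keep _ _) = skip Sx (¬Ax ∘ B⊆A) (follows-restrict B⊆A f ρ)
follows-restrict B⊆A (skip Sx ¬Ax f)    ρ@(drop _ _) = skip Sx (¬Ax ∘ B⊆A) (follows-restrict B⊆A f ρ)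
follows-restrict B⊆A (hit Sx _ f)       (keep Bx ρ)  = hit Sx Bx (follows-restrict B⊆A f ρ)
follows-restrict B⊆A (hit Sx _ f)       (drop ¬Bx ρ) = skip Sx ¬Bx (follows-restrict B⊆A f ρ)

follows-prefix : ∀ ys → Follows S A (ys ++ zs) xs → Follows S A ys xs
follows-prefix []       _                = stop
follows-prefix (y ∷ ys) (skip Sx ¬Ax f)  = skip Sx ¬Ax (follows-prefix (y ∷ ys) f)
follows-prefix (y ∷ ys) (hit Sx Ax f)    = hit Sx Ax (follows-prefix ys f)

follows-++ : All S ys → Follows S S ys (ys ++ zs)
follows-++ []         = stop
follows-++ (Sy ∷ Sys) = hit Sy Sy (follows-++ Sys)

data Label (n : ℕ) : Set where
  own   : Fin n → Label n
  left  : Label n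
  right : Label n

-- ys interleaves ls, rs and own keys in the order prescribed by an automaton.
data Mix {n : ℕ} {State : Set} (Step : State → Label n → State → Set) :
         State → (ls rs ys : List (Fin n)) → Set where
  []    : ∀ {s} → Mix Step s [] [] []
  own   : ∀ {s t} → Step s (own x) t → Mix Step t ls rs ys → Mix Step s ls rs (x ∷ ys)
  left  : ∀ {s t} → Step s left t → Mix Step t ls rs ys → Mix Step s (x ∷ ls) rs (x ∷ ys)
  right : ∀ {s t} → Step s right t → Mix Step t ls rs ys → Mix Step s ls (x ∷ rs) (x ∷ ys)

module _ {State : Set} {Step : State → Label n → State → Set} where

  mix-all : (∀ {c s t} → Step s (own c) t → A c) → ∀ {s} → Mix Step s ls rs ys →
            All A ls → All A rs → All A ys
  mix-all Ac []          _          _          = []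
  mix-all Ac (own st m)  Als        Ars        = Ac st ∷ mix-all Ac m Als Ars
  mix-all Ac (left _ m)  (Al ∷ Als) Ars        = Al ∷ mix-all Ac m Als Ars
  mix-all Ac (right _ m) Als        (Ar ∷ Ars) = Ar ∷ mix-all Ac m Als Ars

  mix-left : (∀ {c s t} → Step s (own c) t → ¬ B c) → ∀ {s} → Mix Step s ls rs ys →
             All B ls → All (¬_ ∘ B) rs → Restricts B ls ys
  mix-left ¬Bc []          _          _            = []
  mix-left ¬Bc (own st m)  Bls        ¬Brs         = drop (¬Bc st) (mix-left ¬Bc m Bls ¬Brs)
  mix-left ¬Bc (left _ m)  (Bl ∷ Bls) ¬Brs         = keep Bl (mix-left ¬Bc m Bls ¬Brs)
  mix-left ¬Bc (right _ m) Bls        (¬Br ∷ ¬Brs) = drop ¬Br (mix-left ¬Bc m Bls ¬Brs)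

  mix-right : (∀ {c s t} → Step s (own c) t → ¬ B c) → ∀ {s} → Mix Step s ls rs ys →
              All (¬_ ∘ B) ls → All B rs → Restricts B rs ys
  mix-right ¬Bc []          _            _          = []
  mix-right ¬Bc (own st m)  ¬Bls         Brs        = drop (¬Bc st) (mix-right ¬Bc m ¬Bls Brs)
  mix-right ¬Bc (left _ m)  (¬Bl ∷ ¬Bls) Brs        = drop ¬Bl (mix-right ¬Bc m ¬Bls Brs)
  mix-right ¬Bc (right _ m) ¬Bls         (Br ∷ Brs) = keep Br (mix-right ¬Bc m ¬Bls Brs)

  -- dist s bounds the number of steps from s before the next one to the chosen side.
  module _ (dist : State → ℕ) (dist≤4 : ∀ s → dist s ≤ 4) where

    private
      left-≤ : ∀ s t {p q} → p ≤ 5 ℕ.* q ℕ.+ dist t → suc p ≤ 5 ℕ.* suc q ℕ.+ dist s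
      left-≤ s t {p} {q} p≤ = begin
        suc p                   ≤⟨ s≤s p≤ ⟩
        suc (5 ℕ.* q ℕ.+ dist t)    ≤⟨ s≤s (ℕ.+-monoʳ-≤ (5 ℕ.* q) (dist≤4 t)) ⟩
        suc (5 ℕ.* q ℕ.+ 4)         ≡⟨ eq q ⟩
        5 ℕ.* suc q               ≤⟨ ℕ.m≤m+n _ _ ⟩
        5 ℕ.* suc q ℕ.+ dist s      ∎
        where
        open ℕ.≤-Reasoning
        eq : ∀ q → suc (5 ℕ.* q ℕ.+ 4) ≡ 5 ℕ.* suc q
        eq = solve-∀

      other-≤ : ∀ {s t p} q → suc (dist t) ≤ dist s → p ≤ 5 ℕ.* q ℕ.+ dist t → suc p ≤ 5 ℕ.* q ℕ.+ dist s
      other-≤ {s} {t} {p} q lt p≤ = begin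
        suc p                 ≤⟨ s≤s p≤ ⟩
        suc (5 ℕ.* q ℕ.+ dist t)  ≡⟨ ℕ.+-suc (5 ℕ.* q) (dist t) ⟨
        5 ℕ.* q ℕ.+ suc (dist t)  ≤⟨ ℕ.+-monoʳ-≤ (5 ℕ.* q) lt ⟩
        5 ℕ.* q ℕ.+ dist s        ∎
        where open ℕ.≤-Reasoning

      descend : ∀ k s {p q} → p ≤ 5 ℕ.* q ℕ.+ dist s → 5 ^ suc k ≤ p → 5 ^ k ≤ q
      descend k s {p} {q} p≤ 5ᵏ≤p = ℕ.≮⇒≥ λ q<5ᵏ → ℕ.<-irrefl refl (begin-strict
        p                  ≤⟨ p≤ ⟩
        5 ℕ.* q ℕ.+ dist s     <⟨ ℕ.+-monoʳ-< (5 ℕ.* q) (s≤s (dist≤4 s)) ⟩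
        5 ℕ.* q ℕ.+ 5          ≡⟨ eq q ⟩
        5 ℕ.* suc q          ≤⟨ ℕ.*-monoʳ-≤ 5 q<5ᵏ ⟩
        5 ℕ.* 5 ^ k          ≤⟨ 5ᵏ≤p ⟩
        p                  ∎)
        where
        open ℕ.≤-Reasoning
        eq : ∀ q → 5 ℕ.* q ℕ.+ 5 ≡ 5 ℕ.* suc q
        eq = solve-∀

    -- A potential argument: every other step lowers `dist`, and a step to the chosen side resets it
    -- to at most 4, so `length ys ≤ 5 * length ls + dist s`. One level thus divides the available
    -- lookahead by at most 5, and 5^d leaves one query at a gadget leaf.
    length-left : ∀ k → (∀ {s c t} → Step s (own c) t → suc (dist t) ≤ dist s) →
                  (∀ {s t} → Step s right t → suc (dist t) ≤ dist s) →
                  ∀ {s} → Mix Step s ls rs ys → 5 ^ suc k ≤ length ys → 5 ^ k ≤ length ls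
    length-left k ow ri {s} m = descend k s (bound m)
      where
      bound : ∀ {s ls rs ys} → Mix Step s ls rs ys → length ys ≤ 5 ℕ.* length ls ℕ.+ dist s
      bound [] = z≤n
      bound {ls = ls} (own {s = s} {t} st m) = other-≤ {s} {t} (length ls) (ow st) (bound m)
      bound (left {s = s} {t} _ m) = left-≤ s t (bound m)
      bound {ls = ls} (right {s = s} {t} st m) = other-≤ {s} {t} (length ls) (ri st) (bound m)

    length-right : ∀ k → (∀ {s c t} → Step s (own c) t → suc (dist t) ≤ dist s) →
                   (∀ {s t} → Step s left t → suc (dist t) ≤ dist s) →
                   ∀ {s} → Mix Step s ls rs ys → 5 ^ suc k ≤ length ys → 5 ^ k ≤ length rs
    length-right k ow le {s} m = descend k s (bound m)
      where
      bound : ∀ {s ls rs ys} → Mix Step s ls rs ys → length ys ≤ 5 ℕ.* length rs ℕ.+ dist s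
      bound [] = z≤n
      bound {rs = rs} (own {s = s} {t} st m) = other-≤ {s} {t} (length rs) (ow st) (bound m)
      bound (right {s = s} {t} _ m) = left-≤ s t (bound m)
      bound {rs = rs} (left {s = s} {t} st m) = other-≤ {s} {t} (length rs) (le st) (bound m)

-- Gadgets and their two trees

data Gadget (n : ℕ) : ℕ → Set where
  leaf : Fin n → Gadget n 0
  node : (L : Gadget n d) (j c j′ : Fin n) (R : Gadget n d) → Gadget n (suc d)

clean : Gadget n d → Tree n
clean (leaf x)          = node leaf x leaf
clean (node L _ c _ R)  = node (clean L) c (clean R)

dirty : Gadget n d → Tree n
dirty (leaf x)          = node leaf x leaf
dirty (node L j c j′ R) = node (node (dirty L) j (node leaf c leaf)) j′ (dirty R)

clean⊆dirty : (g : Gadget n d) → x ∈ᵗ clean g → x ∈ᵗ dirty g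
clean⊆dirty (leaf _)         x∈         = x∈
clean⊆dirty (node L _ _ _ R) (left x∈)  = left (left (clean⊆dirty L x∈))
clean⊆dirty (node L _ _ _ R) root       = left (right root)
clean⊆dirty (node L _ _ _ R) (right x∈) = right (clean⊆dirty R x∈)

<-trans : {u v w : Fin n} → u Fin.< v → v Fin.< w → u Fin.< w
<-trans {u = u} {v} {w} = Fin.<-trans {i = u} {v} {w}

clean-ordered : (g : Gadget n d) → Ordered (dirty g) → Ordered (clean g)
clean-ordered (leaf _) o = o
clean-ordered (node L j c j′ R) (node (node oL _ <j >j) oR <j′ >j′) =
  node (clean-ordered L oL) (clean-ordered R oR)
    (λ w∈ → <-trans (<j (clean⊆dirty L w∈)) (>j root))
    (λ w∈ → <-trans (<j′ (right root)) (>j′ (clean⊆dirty R w∈)))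

-- Automata for the two query orders

module _ {State : Set} (Step : (j c j′ : Fin n) → State → Label n → State → Set) where

  -- On every subgadget, ys induces a run of the automaton, starting in Q.
  Pattern : (Q : State → Set) → Gadget n d → List (Fin n) → Set
  Pattern Q (leaf x)          ys = All (_≡ x) ys
  Pattern Q (node L j c j′ R) ys = ∃ λ s → ∃ λ ls → ∃ λ rs →
    Q s × Mix (Step j c j′) s ls rs ys × Pattern Q L ls × Pattern Q R rs

  pattern-weaken : ∀ {Q} (g : Gadget n d) → Pattern Q g ys → Pattern (λ _ → ⊤) g ys
  pattern-weaken (leaf _)         p                                = p
  pattern-weaken (node L _ _ _ R) (s , ls , rs , _ , m , pL , pR)  =
    s , ls , rs , tt , m , pattern-weaken L pL , pattern-weaken R pR

  -- Removing a query keeps all the runs but changes their starting states. Calmness has to be shown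
  -- at every position of the word, so it is stated for arbitrary starting states.
  pattern-tail : ∀ (g : Gadget n d) → Pattern (λ _ → ⊤) g (y ∷ ys) → Pattern (λ _ → ⊤) g ys
  pattern-tail (leaf _) (_ ∷ p) = p
  pattern-tail (node L _ _ _ R) (_ , _ , _ , _ , own _ m , pL , pR)   =
    _ , _ , _ , tt , m , pL , pR
  pattern-tail (node L _ _ _ R) (_ , _ , _ , _ , left _ m , pL , pR)  =
    _ , _ , _ , tt , m , pattern-tail L pL , pR
  pattern-tail (node L _ _ _ R) (_ , _ , _ , _ , right _ m , pL , pR) =
    _ , _ , _ , tt , m , pL , pattern-tail R pR

data CleanState : Set where
  atOwn atLeft atRight : CleanState

data CleanStep {n : ℕ} (j c j′ : Fin n) : CleanState → Label n → CleanState → Set where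
  own   : CleanStep j c j′ atOwn (own c) atLeft
  left  : CleanStep j c j′ atLeft left atRight
  right : CleanStep j c j′ atRight right atOwn

-- A round of the dirty automaton visits R, L and c; a round of its initial
-- phase also visits j′ and j.
data DirtyState : Set where
  atOuter atInner forced atRight atLeft atOwn : DirtyState

-- The choice at `atOwn` lets one run comprise the initial phase and the later rounds, so the
-- passage between them needs no separate treatment.
data DirtyStep {n : ℕ} (j c j′ : Fin n) : DirtyState → Label n → DirtyState → Set where
  outer   : DirtyStep j c j′ atOuter (own j′) atInner
  inner   : DirtyStep j c j′ atInner (own j) forced
  right₁  : DirtyStep j c j′ forced right atLeft
  right₂  : DirtyStep j c j′ atRight right atLeft
  left    : DirtyStep j c j′ atLeft left atOwn
  again   : DirtyStep j c j′ atOwn (own c) atOuter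
  finish  : DirtyStep j c j′ atOwn (own c) atRight

CleanPattern DirtyPattern : Gadget n d → List (Fin n) → Set
CleanPattern = Pattern CleanStep (λ _ → ⊤)
DirtyPattern = Pattern DirtyStep (λ _ → ⊤)

clean-∈ : ∀ {Q} (g : Gadget n d) → Pattern CleanStep Q g ys → All (_∈ᵗ clean g) ys
clean-∈ (leaf _) p = All.map (λ where refl → root) p
clean-∈ (node L j c j′ R) (_ , _ , _ , _ , m , pL , pR) =
  mix-all (λ where own → root) m (All.map left (clean-∈ L pL)) (All.map right (clean-∈ R pR))

dirty-∈ : ∀ {Q} (g : Gadget n d) → Pattern DirtyStep Q g ys → All (_∈ᵗ dirty g) ys
dirty-∈ (leaf _) p = All.map (λ where refl → root) p
dirty-∈ (node L j c j′ R) (_ , _ , _ , _ , m , pL , pR) =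
  mix-all (λ where outer → root ; inner → left root ; again → left (right root) ; finish → left (right root))
    m (All.map (λ x∈ → left (left x∈)) (dirty-∈ L pL)) (All.map right (dirty-∈ R pR))

module CleanNode {L R : Gadget n d} {j c j′ : Fin n} (o : Ordered (clean (node L j c j′ R))) where

  private
    oL : Ordered (clean L)
    oL = case o of λ where (node oL _ _ _) → oL
    oR : Ordered (clean R)
    oR = case o of λ where (node _ oR _ _) → oR
    L<c : ∀ {w} → w ∈ᵗ clean L → w Fin.< c
    L<c = case o of λ where (node _ _ L<c _) → L<c
    c<R : ∀ {w} → w ∈ᵗ clean R → c Fin.< w
    c<R = case o of λ where (node _ _ _ c<R) → c<R

  clean-left : ∀ {s Q} → Mix (CleanStep j c j′) s ls rs ys →
               Pattern CleanStep Q L ls → Pattern CleanStep Q R rs →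
               Restricts (_∈ᵗ clean L) ls ys
  clean-left m pL pR = mix-left (λ where own c∈ → <-irrefl (L<c c∈)) m (clean-∈ L pL)
    (All.map (λ x∈R x∈L → <-asym (L<c x∈L) (c<R x∈R)) (clean-∈ R pR))

  clean-right : ∀ {s Q} → Mix (CleanStep j c j′) s ls rs ys →
               Pattern CleanStep Q L ls → Pattern CleanStep Q R rs →
                Restricts (_∈ᵗ clean R) rs ys
  clean-right m pL pR = mix-right (λ where own c∈ → <-irrefl (c<R c∈)) m
    (All.map (λ x∈L x∈R → <-asym (L<c x∈L) (c<R x∈R)) (clean-∈ L pL)) (clean-∈ R pR)

clean-length-left : ∀ k {j c j′ : Fin n} {s} → Mix (CleanStep j c j′) s ls rs ys →
                    5 ^ suc k ≤ length ys → 5 ^ k ≤ length ls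
clean-length-left k = length-left dist (λ where
    atOwn → s≤s z≤n ; atLeft → z≤n ; atRight → s≤s (s≤s z≤n))
  k (λ where own → ℕ.≤-refl) (λ where right → ℕ.≤-refl)
  where
  dist : CleanState → ℕ
  dist atLeft  = 0
  dist atOwn   = 1
  dist atRight = 2

clean-length-right : ∀ k {j c j′ : Fin n} {s} → Mix (CleanStep j c j′) s ls rs ys →
                     5 ^ suc k ≤ length ys → 5 ^ k ≤ length rs
clean-length-right k = length-right dist (λ where
    atRight → z≤n ; atLeft → s≤s z≤n ; atOwn → s≤s (s≤s z≤n))
  k (λ where own → ℕ.≤-refl) (λ where left → ℕ.≤-refl)
  where
  dist : CleanState → ℕ
  dist atRight = 0
  dist atLeft  = 1
  dist atOwn   = 2

dirty-length-left : ∀ k {j c j′ : Fin n} {s} → Mix (DirtyStep j c j′) s ls rs ys →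
                    5 ^ suc k ≤ length ys → 5 ^ k ≤ length ls
dirty-length-left k = length-left dist (λ where
    atLeft → z≤n ; atRight → s≤s z≤n ; forced → s≤s z≤n ; atInner → s≤s (s≤s z≤n)
    atOuter → s≤s (s≤s (s≤s z≤n)) ; atOwn → ℕ.≤-refl)
  k (λ where outer → ℕ.≤-refl ; inner → ℕ.≤-refl ; again → ℕ.≤-refl ; finish → s≤s (s≤s z≤n))
  (λ where right₁ → ℕ.≤-refl ; right₂ → ℕ.≤-refl)
  where
  dist : DirtyState → ℕ
  dist atLeft  = 0
  dist atRight = 1
  dist forced  = 1
  dist atInner = 2
  dist atOuter = 3
  -- The longest wait for L: `c`, then `j′`, `j` and R of an initial round. It is the source of the
  -- base 5.
  dist atOwn   = 4

dirty-length-right : ∀ k {j c j′ : Fin n} {s} → Mix (DirtyStep j c j′) s ls rs ys →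
                     5 ^ suc k ≤ length ys → 5 ^ k ≤ length rs
dirty-length-right k = length-right dist (λ where
    atRight → z≤n ; forced → z≤n ; atInner → s≤s z≤n ; atOuter → s≤s (s≤s z≤n)
    atOwn → s≤s (s≤s (s≤s z≤n)) ; atLeft → ℕ.≤-refl)
  k (λ where outer → ℕ.≤-refl ; inner → ℕ.≤-refl ; again → ℕ.≤-refl ; finish → s≤s z≤n)
  (λ where left → ℕ.≤-refl)
  where
  dist : DirtyState → ℕ
  dist atRight = 0
  dist forced  = 0
  dist atInner = 1
  dist atOuter = 2
  dist atOwn   = 3
  dist atLeft  = 4

-- Rules out words that end before the few letters inspected at an inner gadget node.
short : ∀ d {m} {m<5 : True (m ℕ.<? 5)} → ¬ (5 ^ suc d ≤ m)
short d {m<5 = m<5} 5ᵈ≤m =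
  ℕ.<⇒≱ (toWitness m<5) (ℕ.≤-trans (ℕ.m≤m*n 5 (5 ^ d) {{ℕ.m^n≢0 5 d}}) 5ᵈ≤m)

-- A query to `c` ends at the root. After a query in L the next letter is in R, beyond `c` and
-- beyond the whole path in L; after one in R it is `c` itself. In both cases the next query to the
-- gadget hits the interval of the root, and the length bound lets the argument continue in the
-- subgadget.
clean-calm : (g : Gadget n d) → Ordered (clean g) → CleanPattern g (x ∷ ys) →
             Follows S (_∈ᵗ clean g) ys xs → 5 ^ d ≤ length ys → Calm S xs (clean g) x
clean-calm (leaf _) _ (refl ∷ _) _ _ = here
clean-calm {d = suc d} g@(node L j c j′ R) o@(node oL oR L<c c<R) (_ , _ , _ , _ , m , pL , pR) f 5ᵈ≤ with m
... | own own m′ = here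
... | left left [] = contradiction 5ᵈ≤ (short d)
... | left left m′@(right right _) =
  goˡ (L<c (All.head (clean-∈ L pL))) f
    (λ w∈ → <-trans (L<c (∈-path⇒∈ᵗ (clean L) w∈)) (c<R (All.head (clean-∈ R pR))))
    (clean-calm L oL pL
      (follows-restrict left f (CleanNode.clean-left {L = L} {R} {j} {c} {j′} o m′
        (pattern-tail CleanStep L pL) pR))
      (clean-length-left d m′ 5ᵈ≤))
... | right right [] = contradiction 5ᵈ≤ (short d)
... | right right m′@(own own _) =
  goʳ (c<R (All.head (clean-∈ R pR))) f (c<R ∘ ∈-path⇒∈ᵗ (clean R))
    (clean-calm R oR pR
      (follows-restrict right f (CleanNode.clean-right {L = L} {R} {j} {c} {j′} o m′ pL
        (pattern-tail CleanStep R pR)))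
      (clean-length-right d m′ 5ᵈ≤))

clean-rooted : (g : Gadget n d) → Ordered (clean g) → Pattern CleanStep (_≡ atOwn) g ys →
               Follows S (_∈ᵗ clean g) ys xs → 5 ^ d ≤ length ys → Rooted S xs (clean g)
clean-rooted (leaf _) _ []         _ 1≤ = contradiction 1≤ λ ()
clean-rooted (leaf _) _ (refl ∷ _) f _  = node f leaf leaf
clean-rooted {d = suc d} (node L j c j′ R) _ (_ , _ , _ , refl , [] , _ , _) _ 5ᵈ≤ =
  contradiction 5ᵈ≤ (short d)
clean-rooted {d = suc d} (node L j c j′ R) o@(node oL oR _ _) (_ , _ , _ , refl , m@(own own _) , pL , pR) f 5ᵈ≤ =
  node f
    (clean-rooted L oL pL
      (follows-restrict left f (CleanNode.clean-left {L = L} {R} {j} {c} {j′} o m pL pR))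
      (clean-length-left d m 5ᵈ≤))
    (clean-rooted R oR pR
      (follows-restrict right f (CleanNode.clean-right {L = L} {R} {j} {c} {j′} o m pL pR))
      (clean-length-right d m 5ᵈ≤))

module DirtyNode {L R : Gadget n d} {j c j′ : Fin n} (o : Ordered (dirty (node L j c j′ R))) where

  innerTree : Tree n
  innerTree = node (dirty L) j (node leaf c leaf)

  oL : Ordered (dirty L)
  oL = case o of λ where (node (node oL _ _ _) _ _ _) → oL
  oR : Ordered (dirty R)
  oR = case o of λ where (node _ oR _ _) → oR
  L<j : ∀ {w} → w ∈ᵗ dirty L → w Fin.< j
  L<j = case o of λ where (node (node _ _ L<j _) _ _ _) → L<j
  j<c : j Fin.< c
  j<c = case o of λ where (node (node _ _ _ j<) _ _ _) → j< root
  <j′ : ∀ {w} → w ∈ᵗ innerTree → w Fin.< j′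
  <j′ = case o of λ where (node _ _ <j′ _) → <j′
  j′<R : ∀ {w} → w ∈ᵗ dirty R → j′ Fin.< w
  j′<R = case o of λ where (node _ _ _ j′<R) → j′<R
  L<R : x ∈ᵗ dirty L → y ∈ᵗ dirty R → x Fin.< y
  L<R x∈ y∈ = <-trans (<j′ (left x∈)) (j′<R y∈)
  c<j′ : c Fin.< j′
  c<j′ = <j′ (right root)
  j<j′ : j Fin.< j′
  j<j′ = <j′ root

  dirty-left : ∀ {s Q} → Mix (DirtyStep j c j′) s ls rs ys →
               Pattern DirtyStep Q L ls → Pattern DirtyStep Q R rs →
               Restricts (_∈ᵗ dirty L) ls ys
  dirty-left m pL pR = mix-left (λ where
      outer j′∈ → <-irrefl (<j′ (left j′∈))
      inner j∈  → <-irrefl (L<j j∈)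
      again c∈  → <-asym (L<j c∈) j<c
      finish c∈ → <-asym (L<j c∈) j<c)
    m (dirty-∈ L pL) (All.map (λ x∈R x∈L → <-irrefl (L<R x∈L x∈R)) (dirty-∈ R pR))

  dirty-right : ∀ {s Q} → Mix (DirtyStep j c j′) s ls rs ys →
               Pattern DirtyStep Q L ls → Pattern DirtyStep Q R rs →
                Restricts (_∈ᵗ dirty R) rs ys
  dirty-right m pL pR = mix-right (λ where
      outer j′∈ → <-irrefl (j′<R j′∈)
      inner j∈  → <-asym (j′<R j∈) j<j′
      again c∈  → <-asym (j′<R c∈) c<j′
      finish c∈ → <-asym (j′<R c∈) c<j′)
    m (All.map (λ x∈L x∈R → <-irrefl (L<R x∈L x∈R)) (dirty-∈ L pL)) (dirty-∈ R pR)

  j′∉inner : ¬ j′ ∈ᵗ innerTree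
  j′∉inner j′∈ = <-irrefl (<j′ j′∈)

own-c : ∀ {j c j′ : Fin n} {t} → DirtyStep j c j′ atOwn (own a) t → a ≡ c
own-c again  = refl
own-c finish = refl

-- After a query in R the next key, from L, hits the interval of `j′`; after `j` a key of R does.
-- After a query in L the next key is `c`, which lies in the intervals of both `j′` and `j`. After
-- `c` two letters matter: the first hits the interval of `j′`, the second that of `j`.
dirty-calm : (g : Gadget n d) → Ordered (dirty g) → DirtyPattern g (x ∷ ys) →
             Follows S (_∈ᵗ dirty g) ys xs → 5 ^ d ≤ length ys → Calm S xs (dirty g) x
dirty-calm (leaf _) _ (refl ∷ _) _ _ = here
dirty-calm {d = suc d} {S = S} {xs = xs} (node L j c j′ R) o (_ , _ , _ , _ , m , pL , pR) f 5ᵈ≤ = go m pL pR f 5ᵈ≤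
  where
  open DirtyNode {L = L} {R} {j} {c} {j′} o

  go-right : ∀ {s x ls rs ys} → Mix (DirtyStep j c j′) s ls rs ys → s ≡ atLeft →
             DirtyPattern L ls → DirtyPattern R (x ∷ rs) →
             Follows S (_∈ᵗ dirty (node L j c j′ R)) ys xs → 5 ^ suc d ≤ length ys →
             Calm S xs (dirty (node L j c j′ R)) x
  go-right []            refl _ _ _ 5ᵈ≤ = contradiction 5ᵈ≤ (short d)
  go-right m@(left left _) refl pL pR f 5ᵈ≤ =
    goʳ (j′<R (All.head (dirty-∈ R pR))) f (L<R (All.head (dirty-∈ L pL)) ∘ ∈-path⇒∈ᵗ (dirty R))
      (dirty-calm R oR pR
        (follows-restrict right f (dirty-right m pL (pattern-tail DirtyStep R pR)))
        (dirty-length-right d m 5ᵈ≤))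

  -- Here `a` is `j′` or in R, and `b` is `j` or in L, which covers both steps out of `atOwn`. As
  -- `a` is not in the inner tree, `b` is the first query to it.
  go-own : ∀ {a b ys} → Follows S (_∈ᵗ dirty (node L j c j′ R)) (a ∷ b ∷ ys) xs →
           (∀ {w} → w ∈ᵗ innerTree → w Fin.< a) → b ∈ᵗ innerTree → b Fin.< c →
           Calm S xs (dirty (node L j c j′ R)) c
  go-own {a} {b} f <a b∈ b<c =
    goˡ c<j′ f (<a ∘ ∈-path⇒∈ᵗ {x = c} innerTree)
      (goʳ j<c (follows-restrict left (follows-prefix (a ∷ b ∷ []) f)
                  (drop (<-irrefl ∘ <a) (keep b∈ [])))
        (λ w∈ → case ∈-path⇒∈ᵗ {x = c} (node leaf c leaf) w∈ of λ where root → b<c)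
        here)

  go : ∀ {s x ls rs ys} → Mix (DirtyStep j c j′) s ls rs (x ∷ ys) → DirtyPattern L ls → DirtyPattern R rs →
       Follows S (_∈ᵗ dirty (node L j c j′ R)) ys xs → 5 ^ suc d ≤ length ys → Calm S xs (dirty (node L j c j′ R)) x
  go (own outer _) _ _ _ _ = here
  go (own inner []) _ _ _ 5ᵈ≤ = contradiction 5ᵈ≤ (short d)
  go (own inner (right right₁ _)) _ pR f _ =
    goˡ j<j′ f
      (λ w∈ → <-trans (<j′ (∈-path⇒∈ᵗ {x = j} innerTree w∈)) (j′<R (All.head (dirty-∈ R pR)))) here
  go (right right₁ m) pL pR f 5ᵈ≤ = go-right m refl pL pR f 5ᵈ≤
  go (right right₂ m) pL pR f 5ᵈ≤ = go-right m refl pL pR f 5ᵈ≤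
  go (left left []) _ _ _ 5ᵈ≤ = contradiction 5ᵈ≤ (short d)
  go {x = x} (left left m@(own st _)) pL pR f 5ᵈ≤ with own-c st
  ... | refl = goˡ (<j′ (left x∈L)) f (λ w∈ → case ∈-∪⁻ (subst (_ ∈_) (path-< (L<j x∈L)) w∈) of λ where
      (inj₁ refl) → j<c
      (inj₂ w∈L)  → <-trans (L<j (∈-path⇒∈ᵗ (dirty L) w∈L)) j<c)
    (goˡ (L<j x∈L) (follows-restrict left (follows-prefix (c ∷ []) f) (keep (right root) []))
      (λ w∈L → <-trans (L<j (∈-path⇒∈ᵗ (dirty L) w∈L)) j<c)
      (dirty-calm L oL pL
        (follows-restrict (λ x∈ → left (left x∈)) f (dirty-left m (pattern-tail DirtyStep L pL) pR))
        (dirty-length-left d m 5ᵈ≤)))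
    where
    x∈L : x ∈ᵗ dirty L
    x∈L = All.head (dirty-∈ L pL)
  go (own again []) _ _ _ 5ᵈ≤ = contradiction 5ᵈ≤ (short d)
  go (own again (own outer [])) _ _ _ 5ᵈ≤ =
    contradiction 5ᵈ≤ (short d)
  go (own again (own outer (own inner _))) _ _ f _ = go-own f <j′ root j<c
  go (own finish []) _ _ _ 5ᵈ≤ = contradiction 5ᵈ≤ (short d)
  go (own finish (right right₂ [])) _ _ _ 5ᵈ≤ =
    contradiction 5ᵈ≤ (short d)
  go (own finish (right right₂ (left left _))) pL pR f _ =
    go-own f (λ w∈ → <-trans (<j′ w∈) (j′<R (All.head (dirty-∈ R pR)))) (left l∈) (<-trans (L<j l∈) j<c)
    where
    l∈ : _ ∈ᵗ dirty L
    l∈ = All.head (dirty-∈ L pL)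

-- This is what the queries to `j′` and `j` are for: `j′` comes first in the gadget and `j` first in
-- the inner tree, whereas a round R, L, c would put a key of R at the root.
dirty-rooted : (g : Gadget n d) → Ordered (dirty g) → Pattern DirtyStep (_≡ atOuter) g ys →
               Follows S (_∈ᵗ dirty g) ys xs → 5 ^ d ≤ length ys → Rooted S xs (dirty g)
dirty-rooted (leaf _) _ []         _ 1≤ = contradiction 1≤ λ ()
dirty-rooted (leaf _) _ (refl ∷ _) f _  = node f leaf leaf
dirty-rooted {d = suc d} {S = S} {xs = xs} g@(node L j c j′ R) o (_ , _ , _ , refl , m , pL , pR) f 5ᵈ≤ =
  go m pL pR f 5ᵈ≤
  where
  open DirtyNode {L = L} {R} {j} {c} {j′} o

  first-round : ∀ {a b ys} → Follows S (_∈ᵗ dirty g) (j′ ∷ j ∷ a ∷ b ∷ c ∷ ys) xs → c Fin.< a → b Fin.< c →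
                Rooted S xs (dirty L) → Rooted S xs (dirty R) → Rooted S xs (dirty g)
  first-round {a} {b} f c<a b<c rL rR = node f
    (node (follows-restrict left (follows-prefix (j′ ∷ j ∷ []) f) (drop j′∉inner (keep root []))) rL
      (node (follows-restrict (λ where root → left (right root)) (follows-prefix (j′ ∷ j ∷ a ∷ b ∷ c ∷ []) f)
              (drop (λ where root → <-irrefl c<j′) (drop (λ where root → <-irrefl j<c)
                (drop (λ where root → <-irrefl c<a) (drop (λ where root → <-irrefl b<c) (keep root []))))))
        leaf leaf))
    rR

  go : ∀ {ls rs ys} → Mix (DirtyStep j c j′) atOuter ls rs ys →
       Pattern DirtyStep (_≡ atOuter) L ls → Pattern DirtyStep (_≡ atOuter) R rs →
       Follows S (_∈ᵗ dirty g) ys xs → 5 ^ suc d ≤ length ys → Rooted S xs (dirty g)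
  go [] _ _ _ 5ᵈ≤ = contradiction 5ᵈ≤ (short d)
  go (own outer []) _ _ _ 5ᵈ≤ = contradiction 5ᵈ≤ (short d)
  go (own outer (own inner [])) _ _ _ 5ᵈ≤ = contradiction 5ᵈ≤ (short d)
  go (own outer (own inner (right right₁ []))) _ _ _ 5ᵈ≤ = contradiction 5ᵈ≤ (short d)
  go (own outer (own inner (right right₁ (left left [])))) _ _ _ 5ᵈ≤ = contradiction 5ᵈ≤ (short d)
  go m@(own outer (own inner (right right₁ (left left (own st _))))) pL pR f 5ᵈ≤ with own-c st
  ... | refl = first-round f (<-trans c<j′ (j′<R (All.head (dirty-∈ R pR))))
    (<-trans (L<j (All.head (dirty-∈ L pL))) j<c)
    (dirty-rooted L oL pL (follows-restrict (λ x∈ → left (left x∈)) f (dirty-left m pL pR))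
      (dirty-length-left d m 5ᵈ≤))
    (dirty-rooted R oR pR (follows-restrict right f (dirty-right m pL pR))
      (dirty-length-right d m 5ᵈ≤))

-- Query words and their costs

-- Each round takes one letter from either child word, between the fixed words `p` and `q`. Reversal
-- exchanges `p` with `q` and `as` with `bs`, so this one operation yields all four query words.
weave : (p q as bs : List (Fin n)) → List (Fin n)
weave p q (a ∷ as) (b ∷ bs) = p ++ a ∷ b ∷ q ++ weave p q as bs
weave _ _ _        _        = []

length-weave : ∀ p q (as bs : List (Fin n)) → length as ≡ k → length bs ≡ k →
               length (weave p q as bs) ≡ k ℕ.* (length p ℕ.+ (2 ℕ.+ length q))
length-weave p q [] [] refl _ = refl
length-weave p q (a ∷ as) (b ∷ bs) refl eq = begin
  length (p ++ a ∷ b ∷ q ++ weave p q as bs)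
    ≡⟨ length-++ p ⟩
  length p ℕ.+ (2 ℕ.+ length (q ++ weave p q as bs))
    ≡⟨ cong (λ m → length p ℕ.+ (2 ℕ.+ m)) (length-++ q) ⟩
  length p ℕ.+ (2 ℕ.+ (length q ℕ.+ length (weave p q as bs)))
    ≡⟨ cong (λ m → length p ℕ.+ (2 ℕ.+ (length q ℕ.+ m))) (length-weave p q as bs refl (ℕ.suc-injective eq)) ⟩
  length p ℕ.+ (2 ℕ.+ (length q ℕ.+ length as ℕ.* (length p ℕ.+ (2 ℕ.+ length q))))
    ≡⟨ rearranged (length p) (length q) _ ⟩
  length p ℕ.+ (2 ℕ.+ length q) ℕ.+ length as ℕ.* (length p ℕ.+ (2 ℕ.+ length q))
    ∎
  where
  open ≡-Reasoning
  rearranged : ∀ p q m → p ℕ.+ (2 ℕ.+ (q ℕ.+ m)) ≡ p ℕ.+ (2 ℕ.+ q) ℕ.+ m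
  rearranged = solve-∀

total-++ : ∀ h (xs ys : List (Fin n)) → total h (xs ++ ys) ≡ total h xs ℕ.+ total h ys
total-++ h xs ys = trans (cong sum (map-++ h xs ys)) (sum-++ (map h xs) (map h ys))

total-weave : ∀ h p q (as bs : List (Fin n)) → length as ≡ k → length bs ≡ k →
              total h (weave p q as bs) ≡ k ℕ.* (total h p ℕ.+ total h q) ℕ.+ (total h as ℕ.+ total h bs)
total-weave h p q [] [] refl _ = refl
total-weave h p q (a ∷ as) (b ∷ bs) refl eq = begin
  total h (p ++ a ∷ b ∷ q ++ weave p q as bs)
    ≡⟨ total-++ h p _ ⟩
  total h p ℕ.+ (h a ℕ.+ (h b ℕ.+ total h (q ++ weave p q as bs)))
    ≡⟨ cong (λ m → total h p ℕ.+ (h a ℕ.+ (h b ℕ.+ m))) (total-++ h q _) ⟩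
  total h p ℕ.+ (h a ℕ.+ (h b ℕ.+ (total h q ℕ.+ total h (weave p q as bs))))
    ≡⟨ cong (λ m → total h p ℕ.+ (h a ℕ.+ (h b ℕ.+ (total h q ℕ.+ m))))
         (total-weave h p q as bs refl (ℕ.suc-injective eq)) ⟩
  total h p ℕ.+ (h a ℕ.+ (h b ℕ.+ (total h q ℕ.+
    (length as ℕ.* (total h p ℕ.+ total h q) ℕ.+ (total h as ℕ.+ total h bs)))))
    ≡⟨ rearranged (total h p) (total h q) (h a) (h b) _ (total h as) (total h bs) ⟩
  total h p ℕ.+ total h q ℕ.+ length as ℕ.* (total h p ℕ.+ total h q) ℕ.+ (h a ℕ.+ total h as ℕ.+ (h b ℕ.+ total h bs))
    ∎
  where
  open ≡-Reasoning
  rearranged : ∀ p q a b m s t → p ℕ.+ (a ℕ.+ (b ℕ.+ (q ℕ.+ (m ℕ.+ (s ℕ.+ t))))) ≡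
               p ℕ.+ q ℕ.+ m ℕ.+ (a ℕ.+ s ℕ.+ (b ℕ.+ t))
  rearranged = solve-∀

total-shift : ∀ {h h′ : Fin n → ℕ} c → All (λ x → h x ≡ c ℕ.+ h′ x) xs →
              total h xs ≡ length xs ℕ.* c ℕ.+ total h′ xs
total-shift c [] = refl
total-shift {xs = x ∷ xs} {h} {h′} c (eq ∷ eqs) =
  trans (cong₂ ℕ._+_ eq (total-shift c eqs)) (rearranged c (h′ x) (length xs ℕ.* c) (total h′ xs))
  where
  rearranged : ∀ c a m t → c ℕ.+ a ℕ.+ (m ℕ.+ t) ≡ c ℕ.+ m ℕ.+ (a ℕ.+ t)
  rearranged = solve-∀

-- The accumulating form of `reverse-weave`; the accumulators hold the rounds already reversed, so
-- that the induction removes one round at a time.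
weave-ʳ++ : ∀ p q (as bs : List (Fin n)) {as′ bs′} → length as ≡ length bs →
            weave (reverse q) (reverse p) (bs ʳ++ bs′) (as ʳ++ as′) ≡
            weave p q as bs ʳ++ weave (reverse q) (reverse p) bs′ as′
weave-ʳ++ p q [] [] _ = refl
weave-ʳ++ p q (a ∷ as) (b ∷ bs) {as′} {bs′} eq = begin
  weave (reverse q) (reverse p) (bs ʳ++ b ∷ bs′) (as ʳ++ a ∷ as′)
    ≡⟨ weave-ʳ++ p q as bs (ℕ.suc-injective eq) ⟩
  weave p q as bs ʳ++ reverse q ++ b ∷ a ∷ reverse p ++ weave (reverse q) (reverse p) bs′ as′
    ≡⟨ cong (λ ws → weave p q as bs ʳ++ reverse q ++ b ∷ a ∷ ws) (sym (ʳ++-defn p)) ⟩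
  weave p q as bs ʳ++ reverse q ++ b ∷ a ∷ (p ʳ++ weave (reverse q) (reverse p) bs′ as′)
    ≡⟨ cong (weave p q as bs ʳ++_) (sym (ʳ++-defn q)) ⟩
  weave p q as bs ʳ++ q ʳ++ b ∷ a ∷ (p ʳ++ weave (reverse q) (reverse p) bs′ as′)
    ≡⟨ sym (++-ʳ++ q) ⟩
  (q ++ weave p q as bs) ʳ++ b ∷ a ∷ (p ʳ++ weave (reverse q) (reverse p) bs′ as′)
    ≡⟨ sym (++-ʳ++ p) ⟩
  (p ++ a ∷ b ∷ q ++ weave p q as bs) ʳ++ weave (reverse q) (reverse p) bs′ as′
    ∎
  where
  open ≡-Reasoning
  open import Data.List.Properties using (ʳ++-defn; ++-ʳ++)

reverse-weave : ∀ p q (as bs : List (Fin n)) → length as ≡ length bs →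
                reverse (weave p q as bs) ≡ weave (reverse q) (reverse p) (reverse bs) (reverse as)
reverse-weave p q as bs eq = sym (weave-ʳ++ p q as bs eq)

forward forwardStart backward backwardStart : Gadget n d → List (Fin n)
forward (leaf x)          = [ x ]
forward (node L j c j′ R) = weave [ c ] [] (forward L) (forward R)

forwardStart (leaf x)          = [ x ]
forwardStart (node L j c j′ R) = weave [ c ] (j ∷ j′ ∷ []) (forwardStart L) (forwardStart R)

backward (leaf x)          = [ x ]
backward (node L j c j′ R) = weave [] [ c ] (backward R) (backward L)

backwardStart (leaf x)          = [ x ]
backwardStart (node L j c j′ R) = weave (j′ ∷ j ∷ []) [ c ] (backwardStart R) (backwardStart L)

length-forward : (g : Gadget n d) → length (forward g) ≡ 3 ^ d
length-forward (leaf _)                   = refl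
length-forward {d = suc d} (node L _ c _ R) =
  trans (length-weave [ c ] [] (forward L) (forward R) (length-forward L) (length-forward R))
    (ℕ.*-comm (3 ^ d) 3)

length-forwardStart : (g : Gadget n d) → length (forwardStart g) ≡ 5 ^ d
length-forwardStart (leaf _)                   = refl
length-forwardStart {d = suc d} (node L j c j′ R) =
  trans (length-weave [ c ] (j ∷ j′ ∷ []) (forwardStart L) (forwardStart R)
    (length-forwardStart L) (length-forwardStart R)) (ℕ.*-comm (5 ^ d) 5)

length-backward : (g : Gadget n d) → length (backward g) ≡ 3 ^ d
length-backward (leaf _)                   = refl
length-backward {d = suc d} (node L _ c _ R) =
  trans (length-weave [] [ c ] (backward R) (backward L) (length-backward R) (length-backward L))
    (ℕ.*-comm (3 ^ d) 3)

length-backwardStart : (g : Gadget n d) → length (backwardStart g) ≡ 5 ^ d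
length-backwardStart (leaf _)                   = refl
length-backwardStart {d = suc d} (node L j c j′ R) =
  trans (length-weave (j′ ∷ j ∷ []) [ c ] (backwardStart R) (backwardStart L)
    (length-backwardStart R) (length-backwardStart L)) (ℕ.*-comm (5 ^ d) 5)

reverse-forward : (g : Gadget n d) → reverse (forward g) ≡ backward g
reverse-forward (leaf _)         = refl
reverse-forward (node L _ c _ R) = trans
  (reverse-weave [ c ] [] (forward L) (forward R) (trans (length-forward L) (sym (length-forward R))))
  (cong₂ (weave [] [ c ]) (reverse-forward R) (reverse-forward L))

reverse-forwardStart : (g : Gadget n d) → reverse (forwardStart g) ≡ backwardStart g
reverse-forwardStart (leaf _)         = refl
reverse-forwardStart (node L j c j′ R) = trans
  (reverse-weave [ c ] (j ∷ j′ ∷ []) (forwardStart L) (forwardStart R)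
    (trans (length-forwardStart L) (sym (length-forwardStart R))))
  (cong₂ (weave (j′ ∷ j ∷ []) [ c ]) (reverse-forwardStart R) (reverse-forwardStart L))

-- Repeated words and their runs

infixr 8 _^^_

_^^_ : List (Fin n) → ℕ → List (Fin n)
xs ^^ zero  = []
xs ^^ suc k = xs ++ xs ^^ k

^^-+ : ∀ (xs : List (Fin n)) k m → xs ^^ (k ℕ.+ m) ≡ xs ^^ k ++ xs ^^ m
^^-+ xs zero    m = refl
^^-+ xs (suc k) m = trans (cong (xs ++_) (^^-+ xs k m)) (sym (++-assoc xs _ _))

^^-comm : ∀ (xs : List (Fin n)) k → xs ^^ k ++ xs ≡ xs ++ xs ^^ k
^^-comm xs zero    = sym (++-identityʳ xs)
^^-comm xs (suc k) = trans (++-assoc xs _ _) (cong (xs ++_) (^^-comm xs k))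

reverse-^^ : ∀ (xs : List (Fin n)) k → reverse (xs ^^ k) ≡ reverse xs ^^ k
reverse-^^ xs zero    = refl
reverse-^^ xs (suc k) = trans (reverse-++ xs (xs ^^ k))
  (trans (cong (_++ reverse xs) (reverse-^^ xs k)) (^^-comm (reverse xs) k))

total-^^ : ∀ h (xs : List (Fin n)) k → total h (xs ^^ k) ≡ k ℕ.* total h xs
total-^^ h xs zero    = refl
total-^^ h xs (suc k) = trans (total-++ h xs (xs ^^ k)) (cong (total h xs ℕ.+_) (total-^^ h xs k))

length-^^ : ∀ (xs : List (Fin n)) k → 1 ≤ length xs → k ≤ length (xs ^^ k)
length-^^ xs zero    1≤ = z≤n
length-^^ xs (suc k) 1≤ = ℕ.≤-trans (ℕ.+-mono-≤ 1≤ (length-^^ xs k 1≤)) (ℕ.≤-reflexive (sym (length-++ xs)))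

forward-mix : ∀ {j c j′ : Fin n} as bs → length as ≡ length bs →
              Mix (CleanStep j c j′) atOwn us vs xs →
              Mix (CleanStep j c j′) atOwn (as ++ us) (bs ++ vs) (weave [ c ] [] as bs ++ xs)
forward-mix []       []       _  m = m
forward-mix (a ∷ as) (b ∷ bs) eq m = own own (left left (right right (forward-mix as bs (ℕ.suc-injective eq) m)))

forward-pattern : (g : Gadget n d) → Pattern CleanStep (_≡ atOwn) g xs →
                  Pattern CleanStep (_≡ atOwn) g (forward g ++ xs)
forward-pattern (leaf _) p = refl ∷ p
forward-pattern (node L _ _ _ R) (_ , _ , _ , refl , m , pL , pR) =
  _ , _ , _ , refl ,
  forward-mix (forward L) (forward R) (trans (length-forward L) (sym (length-forward R))) m ,
  forward-pattern L pL , forward-pattern R pR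

backward-mix : ∀ {j c j′ : Fin n} as bs → length as ≡ length bs →
               Mix (DirtyStep j c j′) atRight us vs xs →
               Mix (DirtyStep j c j′) atRight (as ++ us) (bs ++ vs) (weave [] [ c ] bs as ++ xs)
backward-mix []       []       _  m = m
backward-mix (a ∷ as) (b ∷ bs) eq m =
  right right₂ (left left (own finish (backward-mix as bs (ℕ.suc-injective eq) m)))

backward-pattern : (g : Gadget n d) → Pattern DirtyStep (_≡ atRight) g xs →
                   Pattern DirtyStep (_≡ atRight) g (backward g ++ xs)
backward-pattern (leaf _) p = refl ∷ p
backward-pattern (node L _ _ _ R) (_ , _ , _ , refl , m , pL , pR) =
  _ , _ , _ , refl ,
  backward-mix (backward L) (backward R) (trans (length-backward L) (sym (length-backward R))) m ,
  backward-pattern L pL , backward-pattern R pR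

-- The induction starts from one round instead of none: the last `c` has to take `finish` in order
-- to reach `atRight`, all earlier ones take `again`.
backwardStart-mix : ∀ {j c j′ a b : Fin n} as bs → length as ≡ length bs →
                    Mix (DirtyStep j c j′) atRight us vs xs →
                    Mix (DirtyStep j c j′) atOuter (a ∷ as ++ us) (b ∷ bs ++ vs)
                      (weave (j′ ∷ j ∷ []) [ c ] (b ∷ bs) (a ∷ as) ++ xs)
backwardStart-mix []       []       _  m = own outer (own inner (right right₁ (left left (own finish m))))
backwardStart-mix (_ ∷ as) (_ ∷ bs) eq m =
  own outer (own inner (right right₁ (left left (own again (backwardStart-mix as bs (ℕ.suc-injective eq) m)))))

backwardStart-pattern : (g : Gadget n d) → Pattern DirtyStep (_≡ atRight) g xs →
                        Pattern DirtyStep (_≡ atOuter) g (backwardStart g ++ xs)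
backwardStart-pattern (leaf _) p = refl ∷ p
backwardStart-pattern {d = suc d} (node L j c j′ R) (_ , ls , rs , refl , m , pL , pR) =
  _ , _ , _ , refl , mixed (backwardStart L) (backwardStart R) (length-backwardStart L) (length-backwardStart R) ,
  backwardStart-pattern L pL , backwardStart-pattern R pR
  where
  mixed : ∀ as bs → length as ≡ 5 ^ d → length bs ≡ 5 ^ d →
          Mix (DirtyStep j c j′) atOuter (as ++ ls) (bs ++ rs) (weave (j′ ∷ j ∷ []) [ c ] bs as ++ _)
  mixed (_ ∷ as) (_ ∷ bs) eqᵃ eqᵇ = backwardStart-mix as bs (ℕ.suc-injective (trans eqᵃ (sym eqᵇ))) m
  mixed [] _ eq _ = contradiction (ℕ.m^n>0 5 d) (ℕ.<⇒≱ (ℕ.≤-reflexive (cong suc (sym eq))))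
  mixed (_ ∷ _) [] _ eq = contradiction (ℕ.m^n>0 5 d) (ℕ.<⇒≱ (ℕ.≤-reflexive (cong suc (sym eq))))

forward-pattern-^^ : ∀ (g : Gadget n d) k → Pattern CleanStep (_≡ atOwn) g (forward g ^^ k)
forward-pattern-^^ (leaf _) zero = []
forward-pattern-^^ (node L _ _ _ R) zero =
  _ , _ , _ , refl , [] , forward-pattern-^^ L zero , forward-pattern-^^ R zero
forward-pattern-^^ g (suc k) = forward-pattern g (forward-pattern-^^ g k)

backward-pattern-^^ : ∀ (g : Gadget n d) k → Pattern DirtyStep (_≡ atRight) g (backward g ^^ k)
backward-pattern-^^ (leaf _) zero = []
backward-pattern-^^ (node L _ _ _ R) zero =
  _ , _ , _ , refl , [] , backward-pattern-^^ L zero , backward-pattern-^^ R zero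
backward-pattern-^^ g (suc k) = backward-pattern g (backward-pattern-^^ g k)

-- The buffer `ys` continues the pattern and supplies the lookahead for the last letters of `xs`;
-- beyond it `zs` is arbitrary.
clean-calms : (g : Gadget n d) → Ordered (clean g) → ∀ xs → CleanPattern g (xs ++ ys) →
              5 ^ d ≤ length ys → Calms (clean g) xs (ys ++ zs)
clean-calms g o [] p 5ᵈ≤ = []
clean-calms {ys = ys} {zs = zs} g o (x ∷ xs) p 5ᵈ≤ =
  subst (λ ws → Calm (_∈ᵗ clean g) ws (clean g) x) (++-assoc xs ys zs)
    (clean-calm g o p (follows-++ (clean-∈ g p′))
      (ℕ.≤-trans 5ᵈ≤ (ℕ.≤-trans (ℕ.m≤n+m _ (length xs)) (ℕ.≤-reflexive (sym (length-++ xs))))))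
  ∷ clean-calms g o xs p′ 5ᵈ≤
  where
  p′ : CleanPattern g (xs ++ ys)
  p′ = pattern-tail CleanStep g p

dirty-calms : (g : Gadget n d) → Ordered (dirty g) → ∀ xs → DirtyPattern g (xs ++ ys) →
              5 ^ d ≤ length ys → Calms (dirty g) xs (ys ++ zs)
dirty-calms g o [] p 5ᵈ≤ = []
dirty-calms {ys = ys} {zs = zs} g o (x ∷ xs) p 5ᵈ≤ =
  subst (λ ws → Calm (_∈ᵗ dirty g) ws (dirty g) x) (++-assoc xs ys zs)
    (dirty-calm g o p (follows-++ (dirty-∈ g p′))
      (ℕ.≤-trans 5ᵈ≤ (ℕ.≤-trans (ℕ.m≤n+m _ (length xs)) (ℕ.≤-reflexive (sym (length-++ xs))))))
  ∷ dirty-calms g o xs p′ 5ᵈ≤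
  where
  p′ : DirtyPattern g (xs ++ ys)
  p′ = pattern-tail DirtyStep g p

-- Total depths in the two trees

∣⁅x⁆∪p∣ : (x : Fin n) (p : Subset n) → x ∉ p → ∣ ⁅ x ⁆ ∪ p ∣ ≡ suc ∣ p ∣
∣⁅x⁆∪p∣ Fin.zero    (outside ∷ p) _   = cong (suc ∘ ∣_∣) (∪-identityˡ p)
∣⁅x⁆∪p∣ Fin.zero    (inside ∷ p)  x∉p = contradiction here x∉p
∣⁅x⁆∪p∣ (Fin.suc x) (outside ∷ p) x∉p = ∣⁅x⁆∪p∣ x p (x∉p ∘ there)
∣⁅x⁆∪p∣ (Fin.suc x) (inside ∷ p)  x∉p = cong suc (∣⁅x⁆∪p∣ x p (x∉p ∘ there))

depth-root : ∀ l (v : Fin n) r → depth (node l v r) v ≡ 1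
depth-root l v r = trans (cong ∣_∣ (path-≡ l v r)) (∣⁅x⁆∣≡1 v)

depth-left : Ordered (node l v r) → x ∈ᵗ l → depth (node l v r) x ≡ suc (depth l x)
depth-left {l = l} (node _ _ <v _) x∈ = trans (cong ∣_∣ (path-< (<v x∈)))
  (∣⁅x⁆∪p∣ _ _ (<-irrefl ∘ <v ∘ ∈-path⇒∈ᵗ l))

depth-right : Ordered (node l v r) → x ∈ᵗ r → depth (node l v r) x ≡ suc (depth r x)
depth-right {r = r} (node _ _ _ >v) x∈ = trans (cong ∣_∣ (path-> (>v x∈)))
  (∣⁅x⁆∪p∣ _ _ (<-irrefl ∘ >v ∘ ∈-path⇒∈ᵗ r))

-- A level has 3^d rounds. A clean round adds 1 for `c` and 1 for each of L and R, which move one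
-- level down; a dirty round adds 3 for `c`, 1 for R and 2 for L.
cleanCost dirtyCost : ℕ → ℕ
cleanCost zero    = 1
cleanCost (suc d) = 3 ℕ.* 3 ^ d ℕ.+ 2 ℕ.* cleanCost d
dirtyCost zero    = 1
dirtyCost (suc d) = 6 ℕ.* 3 ^ d ℕ.+ 2 ℕ.* dirtyCost d

forward-∈ : (g : Gadget n d) → All (_∈ᵗ clean g) (forward g)
forward-∈ g = subst (All (_∈ᵗ clean g)) (++-identityʳ (forward g)) (clean-∈ g (forward-pattern-^^ g 1))

backward-∈ : (g : Gadget n d) → All (_∈ᵗ dirty g) (backward g)
backward-∈ g = subst (All (_∈ᵗ dirty g)) (++-identityʳ (backward g)) (dirty-∈ g (backward-pattern-^^ g 1))

total-forward : (g : Gadget n d) → Ordered (clean g) → total (depth (clean g)) (forward g) ≡ cleanCost d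
total-forward (leaf x) _ = trans (ℕ.+-identityʳ _) (depth-root leaf x leaf)
total-forward {d = suc d} g@(node L _ c _ R) o@(node oL oR _ _) = begin
  total h (forward g)
    ≡⟨ total-weave h [ c ] [] (forward L) (forward R) (length-forward L) (length-forward R) ⟩
  3 ^ d ℕ.* (h c ℕ.+ 0 ℕ.+ 0) ℕ.+ (total h (forward L) ℕ.+ total h (forward R))
    ≡⟨ cong₂ (λ a b → 3 ^ d ℕ.* (a ℕ.+ 0 ℕ.+ 0) ℕ.+ b) (depth-root (clean L) c (clean R)) (cong₂ ℕ._+_
         (trans (total-shift 1 (All.map (depth-left o) (forward-∈ L)))
           (cong₂ (λ a b → a ℕ.* 1 ℕ.+ b) (length-forward L) (total-forward L oL)))
         (trans (total-shift 1 (All.map (depth-right o) (forward-∈ R)))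
           (cong₂ (λ a b → a ℕ.* 1 ℕ.+ b) (length-forward R) (total-forward R oR)))) ⟩
  3 ^ d ℕ.* 1 ℕ.+ (3 ^ d ℕ.* 1 ℕ.+ cleanCost d ℕ.+ (3 ^ d ℕ.* 1 ℕ.+ cleanCost d))
    ≡⟨ collect (3 ^ d) (cleanCost d) ⟩
  3 ℕ.* 3 ^ d ℕ.+ 2 ℕ.* cleanCost d
    ∎
  where
  open ≡-Reasoning
  h : Fin _ → ℕ
  h = depth (clean g)
  collect : ∀ k c → k ℕ.* 1 ℕ.+ (k ℕ.* 1 ℕ.+ c ℕ.+ (k ℕ.* 1 ℕ.+ c)) ≡ 3 ℕ.* k ℕ.+ 2 ℕ.* c
  collect = solve-∀

total-backward : (g : Gadget n d) → Ordered (dirty g) → total (depth (dirty g)) (backward g) ≡ dirtyCost d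
total-backward (leaf x) _ = trans (ℕ.+-identityʳ _) (depth-root leaf x leaf)
total-backward {d = suc d} g@(node L j c j′ R) o@(node oI@(node oL _ _ _) oR _ _) = begin
  total h (backward g)
    ≡⟨ total-weave h [] [ c ] (backward R) (backward L) (length-backward R) (length-backward L) ⟩
  3 ^ d ℕ.* (h c ℕ.+ 0) ℕ.+ (total h (backward R) ℕ.+ total h (backward L))
    ≡⟨ cong₂ (λ a b → 3 ^ d ℕ.* (a ℕ.+ 0) ℕ.+ b) depth-c (cong₂ ℕ._+_
         (trans (total-shift 1 (All.map (depth-right o) (backward-∈ R)))
           (cong₂ (λ a b → a ℕ.* 1 ℕ.+ b) (length-backward R) (total-backward R oR)))
         (trans (total-shift 2 (All.map depth-L (backward-∈ L)))
           (cong₂ (λ a b → a ℕ.* 2 ℕ.+ b) (length-backward L) (total-backward L oL)))) ⟩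
  3 ^ d ℕ.* 3 ℕ.+ (3 ^ d ℕ.* 1 ℕ.+ dirtyCost d ℕ.+ (3 ^ d ℕ.* 2 ℕ.+ dirtyCost d))
    ≡⟨ collect (3 ^ d) (dirtyCost d) ⟩
  6 ℕ.* 3 ^ d ℕ.+ 2 ℕ.* dirtyCost d
    ∎
  where
  open ≡-Reasoning
  h : Fin _ → ℕ
  h = depth (dirty g)
  depth-L : ∀ {x} → x ∈ᵗ dirty L → h x ≡ 2 ℕ.+ depth (dirty L) x
  depth-L x∈ = trans (depth-left o (left x∈)) (cong suc (depth-left oI x∈))
  depth-c : h c ≡ 3
  depth-c = trans (depth-left o (right root)) (cong suc
    (trans (depth-right oI root) (cong suc (depth-root leaf c leaf))))
  collect : ∀ k c → k ℕ.* 3 ℕ.+ (k ℕ.* 1 ℕ.+ c ℕ.+ (k ℕ.* 2 ℕ.+ c)) ≡ 6 ℕ.* k ℕ.+ 2 ℕ.* c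
  collect = solve-∀

-- Inner nodes contribute exactly twice as much in the dirty tree; each of the 2^d leaves
-- contributes 1 in both and so causes a defect of 1.
dirtyCost+2^d : ∀ d → dirtyCost d ℕ.+ 2 ^ d ≡ 2 ℕ.* cleanCost d
dirtyCost+2^d zero    = refl
dirtyCost+2^d (suc d) = begin
  6 ℕ.* 3 ^ d ℕ.+ 2 ℕ.* dirtyCost d ℕ.+ 2 ℕ.* 2 ^ d       ≡⟨ factor (3 ^ d) (dirtyCost d) (2 ^ d) ⟩
  2 ℕ.* (3 ℕ.* 3 ^ d ℕ.+ (dirtyCost d ℕ.+ 2 ^ d))       ≡⟨ cong (λ m → 2 ℕ.* (3 ℕ.* 3 ^ d ℕ.+ m)) (dirtyCost+2^d d) ⟩
  2 ℕ.* (3 ℕ.* 3 ^ d ℕ.+ 2 ℕ.* cleanCost d)             ∎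
  where
  open ≡-Reasoning
  factor : ∀ k c e → 6 ℕ.* k ℕ.+ 2 ℕ.* c ℕ.+ 2 ℕ.* e ≡ 2 ℕ.* (3 ℕ.* k ℕ.+ (c ℕ.+ e))
  factor = solve-∀

-- Bounds the relative size of the defect 2^d by 1/(d + 1).
cleanCost-≥ : ∀ d → suc d ℕ.* 2 ^ d ≤ cleanCost d
cleanCost-≥ zero    = ℕ.≤-refl
cleanCost-≥ (suc d) = begin
  suc (suc d) ℕ.* 2 ^ suc d                ≡⟨ factor d (2 ^ d) ⟩
  2 ^ suc d ℕ.+ 2 ℕ.* (suc d ℕ.* 2 ^ d)
    ≤⟨ ℕ.+-mono-≤ (ℕ.^-monoˡ-≤ (suc d) (s≤s (s≤s z≤n))) (ℕ.*-monoʳ-≤ 2 (cleanCost-≥ d)) ⟩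
  3 ^ suc d ℕ.+ 2 ℕ.* cleanCost d            ∎
  where
  open ℕ.≤-Reasoning
  factor : ∀ d e → suc (suc d) ℕ.* (2 ℕ.* e) ≡ 2 ℕ.* e ℕ.+ 2 ℕ.* (suc d ℕ.* e)
  factor = solve-∀

-- Gadgets on a search path

-- With at least 2^(k+1) keys, one of the two subtrees has at least 2^k, and descending into it adds
-- the root to the path. The root exceeds or precedes all keys collected below, so it is put at the
-- corresponding end of `zs`.
deep-path : ∀ k (T : Tree n) → Ordered T → 2 ^ k ≤ length (inorder T) →
            ∃ λ y → ∃ λ zs → y ∈ᵗ T × AllPairs Fin._<_ zs × All (_∈ path y T) zs × k ≤ length zs
deep-path k leaf _ 2ᵏ≤ = contradiction 2ᵏ≤ (ℕ.<⇒≱ (ℕ.m^n>0 2 k))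
deep-path zero (node l v r) _ _ = v , [] , root , [] , [] , z≤n
deep-path (suc k) (node l v r) (node ol or <v >v) 2ᵏ≤
  with 2 ^ k ℕ.≤? length (inorder l) | 2 ^ k ℕ.≤? length (inorder r)
... | yes 2ᵏ≤l | _ with deep-path k l ol 2ᵏ≤l
...   | y , zs , y∈ , incr , onPath , k≤ =
  y , zs ++ [ v ] , left y∈ ,
  AllPairs.++⁺ incr ([] ∷ []) (All.map (λ z∈ → <v (∈-path⇒∈ᵗ l z∈) ∷ []) onPath) ,
  subst (λ P → All (_∈ P) (zs ++ [ v ])) (sym (path-< (<v y∈)))
    (All.++⁺ (All.map (q⊆p∪q ⁅ v ⁆ _) onPath) (p⊆p∪q _ (x∈⁅x⁆ v) ∷ [])) ,
  subst (suc k ≤_) (trans (ℕ.+-comm 1 (length zs)) (sym (length-++ zs))) (s≤s k≤)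
deep-path (suc k) (node l v r) (node ol or <v >v) 2ᵏ≤ | no _ | yes 2ᵏ≤r with deep-path k r or 2ᵏ≤r
...   | y , zs , y∈ , incr , onPath , k≤ =
  y , v ∷ zs , right y∈ , All.map (>v ∘ ∈-path⇒∈ᵗ r) onPath ∷ incr ,
  subst (λ P → All (_∈ P) (v ∷ zs)) (sym (path-> (>v y∈)))
    (p⊆p∪q _ (x∈⁅x⁆ v) ∷ All.map (q⊆p∪q ⁅ v ⁆ _) onPath) ,
  s≤s k≤
deep-path (suc k) (node l v r) _ 2ᵏ≤ | no 2ᵏ≰l | no 2ᵏ≰r = contradiction 2ᵏ≤ (ℕ.<⇒≱ (begin-strict
  length (inorder l ++ v ∷ inorder r)            ≡⟨ length-++ (inorder l) ⟩
  length (inorder l) ℕ.+ suc (length (inorder r))  <⟨ ℕ.+-mono-<-≤ (ℕ.≰⇒> 2ᵏ≰l) (ℕ.≰⇒> 2ᵏ≰r) ⟩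
  2 ^ k ℕ.+ 2 ^ k                                  ≡⟨ cong (2 ^ k ℕ.+_) (ℕ.+-identityʳ _) ⟨
  2 ^ suc k                                      ∎))
  where open ℕ.≤-Reasoning

gadgetSize : ℕ → ℕ
gadgetSize zero    = 1
gadgetSize (suc d) = gadgetSize d ℕ.+ (3 ℕ.+ gadgetSize d)

gadget : ∀ d (xs : List (Fin n)) → gadgetSize d ≤ length xs →
         Σ[ g ∈ Gadget n d ] ∃ λ zs → xs ≡ inorder (dirty g) ++ zs
gadget zero    (x ∷ xs) _  = leaf x , xs , refl
gadget (suc d) xs       ≤xs with gadget d xs (ℕ.≤-trans (ℕ.m≤m+n _ _) ≤xs)
... | L , ys , refl = rest ys (ℕ.+-cancelˡ-≤ (gadgetSize d) _ _ (ℕ.≤-trans ≤xs (ℕ.≤-reflexive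
        (trans (length-++ (inorder (dirty L))) (cong (ℕ._+ length ys) (size L))))))
  where
  size : ∀ {d} (g : Gadget _ d) → length (inorder (dirty g)) ≡ gadgetSize d
  size (leaf _) = refl
  size {suc d} (node L j c j′ R) = begin
    length ((inorder (dirty L) ++ j ∷ [ c ]) ++ j′ ∷ inorder (dirty R))
      ≡⟨ cong length (++-assoc (inorder (dirty L)) _ _) ⟩
    length (inorder (dirty L) ++ j ∷ c ∷ j′ ∷ inorder (dirty R))
      ≡⟨ length-++ (inorder (dirty L)) ⟩
    length (inorder (dirty L)) ℕ.+ (3 ℕ.+ length (inorder (dirty R)))
      ≡⟨ cong₂ (λ a b → a ℕ.+ (3 ℕ.+ b)) (size L) (size R) ⟩
    gadgetSize d ℕ.+ (3 ℕ.+ gadgetSize d) ∎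
    where open ≡-Reasoning
  rest : ∀ ys → 3 ℕ.+ gadgetSize d ≤ length ys →
         Σ[ g ∈ Gadget _ (suc d) ] ∃ λ zs → inorder (dirty L) ++ ys ≡ inorder (dirty g) ++ zs
  rest (j ∷ c ∷ j′ ∷ ys) (s≤s (s≤s (s≤s ≤ys))) with gadget d ys ≤ys
  ... | R , zs , refl = node L j c j′ R , zs ,
    trans (sym (++-assoc (inorder (dirty L)) (j ∷ [ c ]) _))
      (sym (++-assoc (inorder (dirty L) ++ j ∷ [ c ]) (j′ ∷ inorder (dirty R)) zs))

-- Cost bounds and choice of parameters

touched : Algorithm n → Tree n → Fin n → List (Fin n) → Subset n
touched 𝒜 T x xs = path x T ∪ minimalSubtree T (rotated (proj₂ (𝒜 T x xs)))

cost-≤ : (𝒜 : Algorithm n) → ∀ xs T → cost 𝒜 xs T ≤ length xs ℕ.* n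
cost-≤ 𝒜 []       T = z≤n
cost-≤ 𝒜 (x ∷ xs) T =
  ℕ.+-mono-≤ (∣p∣≤n (touched 𝒜 T x xs)) (cost-≤ 𝒜 xs (proj₁ (𝒜 T x xs)))

module _ {Σ₀ : Tree n} (T : BST n) (y : Fin n) (o : Ordered Σ₀)
         (Σ₀⊆path : ∀ {w} → w ∈ᵗ Σ₀ → w ∈ path y (tree T))
         (rooted : Rooted (_∈ᵗ Σ₀) (xs ++ ys) Σ₀) (calms : Calms Σ₀ xs ys) where

  private
    T₁ : Tree n
    T₁ = proj₁ (GF (tree T) y (xs ++ ys))

    calm-cost : cost GF (xs ++ ys) T₁ ≡ total (depth Σ₀) xs ℕ.+ cost GF ys T₁
    calm-cost = cost-calms o (GF-top T y (xs ++ ys) o Σ₀⊆path rooted) calms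

  -- The query `y` installs `Σ₀` on top, and during `xs` the costs are depths in `Σ₀`. For `y`
  -- itself and for `ys` the trivial bound n per query is used.
  cost-upper : cost GF (y ∷ xs ++ ys) (tree T) ≤ n ℕ.+ (total (depth Σ₀) xs ℕ.+ length ys ℕ.* n)
  cost-upper = ℕ.+-mono-≤ (∣p∣≤n (touched GF (tree T) y (xs ++ ys)))
    (ℕ.≤-trans (ℕ.≤-reflexive calm-cost) (ℕ.+-monoʳ-≤ (total (depth Σ₀) xs) (cost-≤ GF ys T₁)))

  cost-lower : total (depth Σ₀) xs ≤ cost GF (y ∷ xs ++ ys) (tree T)
  cost-lower = ℕ.≤-trans (ℕ.m≤m+n _ (cost GF ys T₁))
    (ℕ.≤-trans (ℕ.≤-reflexive (sym calm-cost)) (ℕ.m≤n+m _ ∣ touched GF (tree T) y (xs ++ ys) ∣))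

-- With clean cost c, dirty cost δ = 2c - e, m repetitions and overhead b, the claim reduces to (2k
-- + 1)b + (k + 1)me ≤ mc. One half of mc pays for the overhead, by the choice of m and 1 ≤ c; the
-- other half pays for the defect, by 2(k + 1)e ≤ c.
balance : ∀ k {c e δ m b X R} → δ ℕ.+ e ≡ 2 ℕ.* c → 2 ℕ.* suc k ℕ.* e ≤ c → 1 ≤ c → m ≡ 2 ℕ.* (2 ℕ.* k ℕ.+ 1) ℕ.* b →
          X ≤ b ℕ.+ m ℕ.* c → m ℕ.* δ ≤ R → (2 ℕ.* k ℕ.+ 1) ℕ.* X ≤ suc k ℕ.* R
balance k {c} {e} {δ} {m} {b} {X} {R} δ+e≡2c e≤ 1≤c m≡ X≤ ≤R =
  ℕ.≤-trans (ℕ.*-monoʳ-≤ (2 ℕ.* k ℕ.+ 1) X≤)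
    (ℕ.≤-trans (ℕ.*-cancelˡ-≤ 2 (ℕ.+-cancelʳ-≤ (m ℕ.* (2 ℕ.* suc k ℕ.* e)) _ _ main)) (ℕ.*-monoʳ-≤ (suc k) ≤R))
  where
  open ℕ.≤-Reasoning
  e₁ : ∀ k b m c e → 2 ℕ.* ((2 ℕ.* k ℕ.+ 1) ℕ.* (b ℕ.+ m ℕ.* c)) ℕ.+ m ℕ.* (2 ℕ.* (1 ℕ.+ k) ℕ.* e) ≡
                     2 ℕ.* (2 ℕ.* k ℕ.+ 1) ℕ.* b ℕ.* 1 ℕ.+ m ℕ.* (2 ℕ.* (1 ℕ.+ k) ℕ.* e) ℕ.+ (4 ℕ.* k ℕ.+ 2) ℕ.* (m ℕ.* c)
  e₁ = solve-∀
  e₂ : ∀ k m c → m ℕ.* c ℕ.+ m ℕ.* c ℕ.+ (4 ℕ.* k ℕ.+ 2) ℕ.* (m ℕ.* c) ≡ 2 ℕ.* ((1 ℕ.+ k) ℕ.* (m ℕ.* (2 ℕ.* c)))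
  e₂ = solve-∀
  e₃ : ∀ k m δ e → 2 ℕ.* ((1 ℕ.+ k) ℕ.* (m ℕ.* (δ ℕ.+ e))) ≡
       2 ℕ.* ((1 ℕ.+ k) ℕ.* (m ℕ.* δ)) ℕ.+ m ℕ.* (2 ℕ.* (1 ℕ.+ k) ℕ.* e)
  e₃ = solve-∀
  main : 2 ℕ.* ((2 ℕ.* k ℕ.+ 1) ℕ.* (b ℕ.+ m ℕ.* c)) ℕ.+ m ℕ.* (2 ℕ.* suc k ℕ.* e) ≤
         2 ℕ.* (suc k ℕ.* (m ℕ.* δ)) ℕ.+ m ℕ.* (2 ℕ.* suc k ℕ.* e)
  main = begin
    2 ℕ.* ((2 ℕ.* k ℕ.+ 1) ℕ.* (b ℕ.+ m ℕ.* c)) ℕ.+ m ℕ.* (2 ℕ.* suc k ℕ.* e)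
      ≡⟨ e₁ k b m c e ⟩
    2 ℕ.* (2 ℕ.* k ℕ.+ 1) ℕ.* b ℕ.* 1 ℕ.+ m ℕ.* (2 ℕ.* suc k ℕ.* e) ℕ.+ (4 ℕ.* k ℕ.+ 2) ℕ.* (m ℕ.* c)
      ≡⟨ cong (λ i → i ℕ.* 1 ℕ.+ m ℕ.* (2 ℕ.* suc k ℕ.* e) ℕ.+ (4 ℕ.* k ℕ.+ 2) ℕ.* (m ℕ.* c)) m≡ ⟨
    m ℕ.* 1 ℕ.+ m ℕ.* (2 ℕ.* suc k ℕ.* e) ℕ.+ (4 ℕ.* k ℕ.+ 2) ℕ.* (m ℕ.* c)
      ≤⟨ ℕ.+-monoˡ-≤ _ (ℕ.+-mono-≤ (ℕ.*-monoʳ-≤ m 1≤c) (ℕ.*-monoʳ-≤ m e≤)) ⟩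
    m ℕ.* c ℕ.+ m ℕ.* c ℕ.+ (4 ℕ.* k ℕ.+ 2) ℕ.* (m ℕ.* c)
      ≡⟨ e₂ k m c ⟩
    2 ℕ.* (suc k ℕ.* (m ℕ.* (2 ℕ.* c)))
      ≡⟨ cong (λ i → 2 ℕ.* (suc k ℕ.* (m ℕ.* i))) δ+e≡2c ⟨
    2 ℕ.* (suc k ℕ.* (m ℕ.* (δ ℕ.+ e)))
      ≡⟨ e₃ k m δ e ⟩
    2 ℕ.* (suc k ℕ.* (m ℕ.* δ)) ℕ.+ m ℕ.* (2 ℕ.* suc k ℕ.* e) ∎

module Construction (T : BST n) (y : Fin n) (g : Gadget n d) (o : Ordered (dirty g))
                    (g⊆path : ∀ {w} → w ∈ᵗ dirty g → w ∈ path y (tree T)) (m : ℕ) where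

  buffer : ℕ
  buffer = 5 ^ d

  tailᶠ tailᵇ : List (Fin n)
  tailᶠ = forwardStart g ++ [ y ]
  tailᵇ = backward g ^^ buffer ++ [ y ]

  -- With `y` at both ends, either direction begins by searching `y` in the given tree.
  -- `forwardStart` stands near the end so that the reversal opens with the initial phase.
  queries : List (Fin n)
  queries = y ∷ forward g ^^ m ++ forward g ^^ buffer ++ tailᶠ

  backward-split : backwardStart g ++ backward g ^^ (m ℕ.+ buffer) ≡
                   (backwardStart g ++ backward g ^^ m) ++ backward g ^^ buffer
  backward-split = trans (cong (backwardStart g ++_) (^^-+ (backward g) m buffer))
    (sym (++-assoc (backwardStart g) _ _))

  reverse-queries : reverse queries ≡ y ∷ (backwardStart g ++ backward g ^^ m) ++ tailᵇ
  reverse-queries = begin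
    reverse (y ∷ F m ++ F buffer ++ forwardStart g ++ [ y ])
      ≡⟨ cong (reverse ∘ (y ∷_)) (trans (sym (++-assoc (F m) _ _)) (cong (_++ _) (sym (^^-+ (forward g) m buffer)))) ⟩
    reverse (y ∷ F (m ℕ.+ buffer) ++ forwardStart g ++ [ y ])
      ≡⟨ cong (reverse ∘ (y ∷_)) (++-assoc (F (m ℕ.+ buffer)) _ _) ⟨
    reverse ((y ∷ F (m ℕ.+ buffer) ++ forwardStart g) ++ [ y ])
      ≡⟨ reverse-++ (y ∷ F (m ℕ.+ buffer) ++ forwardStart g) [ y ] ⟩
    y ∷ reverse (y ∷ F (m ℕ.+ buffer) ++ forwardStart g)
      ≡⟨ cong (y ∷_) (unfold-reverse y (F (m ℕ.+ buffer) ++ forwardStart g)) ⟩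
    y ∷ reverse (F (m ℕ.+ buffer) ++ forwardStart g) ++ [ y ]
      ≡⟨ cong (λ ws → y ∷ ws ++ [ y ]) (reverse-++ (F (m ℕ.+ buffer)) _) ⟩
    y ∷ (reverse (forwardStart g) ++ reverse (F (m ℕ.+ buffer))) ++ [ y ]
      ≡⟨ cong₂ (λ us vs → y ∷ (us ++ vs) ++ [ y ]) (reverse-forwardStart g)
           (trans (reverse-^^ (forward g) (m ℕ.+ buffer)) (cong (_^^ (m ℕ.+ buffer)) (reverse-forward g))) ⟩
    y ∷ (backwardStart g ++ backward g ^^ (m ℕ.+ buffer)) ++ [ y ]
      ≡⟨ cong (λ ws → y ∷ ws ++ [ y ]) backward-split ⟩
    y ∷ ((backwardStart g ++ backward g ^^ m) ++ backward g ^^ buffer) ++ [ y ]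
      ≡⟨ cong (y ∷_) (++-assoc (backwardStart g ++ backward g ^^ m) _ _) ⟩
    y ∷ (backwardStart g ++ backward g ^^ m) ++ tailᵇ ∎
    where
    open ≡-Reasoning
    F : ℕ → List (Fin n)
    F = forward g ^^_

  forward-upper : cost GF queries (tree T) ≤
                  n ℕ.+ length (forward g ^^ buffer ++ tailᶠ) ℕ.* n ℕ.+ m ℕ.* cleanCost d
  forward-upper = ℕ.≤-trans
    (cost-upper T y oᶜ (g⊆path ∘ clean⊆dirty g) rooted calms)
    (ℕ.≤-reflexive (trans
      (cong (λ t → n ℕ.+ (t ℕ.+ rest)) (trans (total-^^ _ (forward g) m) (cong (m ℕ.*_) (total-forward g oᶜ))))
      (rearranged n (m ℕ.* cleanCost d) rest)))
    where
    rest : ℕ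
    rest = length (forward g ^^ buffer ++ tailᶠ) ℕ.* n
    rearranged : ∀ a b c → a ℕ.+ (b ℕ.+ c) ≡ a ℕ.+ c ℕ.+ b
    rearranged = solve-∀
    oᶜ : Ordered (clean g)
    oᶜ = clean-ordered g o
    pat : Pattern CleanStep (_≡ atOwn) g (forward g ^^ m ++ forward g ^^ buffer)
    pat = subst (Pattern CleanStep (_≡ atOwn) g) (^^-+ (forward g) m buffer)
      (forward-pattern-^^ g (m ℕ.+ buffer))
    pat′ : CleanPattern g (forward g ^^ m ++ forward g ^^ buffer)
    pat′ = pattern-weaken CleanStep g pat
    long : 5 ^ d ≤ length (forward g ^^ buffer)
    long = length-^^ (forward g) buffer
      (ℕ.≤-trans (ℕ.m^n>0 3 d) (ℕ.≤-reflexive (sym (length-forward g))))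
    calms : Calms (clean g) (forward g ^^ m) (forward g ^^ buffer ++ tailᶠ)
    calms = clean-calms {ys = forward g ^^ buffer} g oᶜ (forward g ^^ m) pat′ long
    rooted : Rooted (_∈ᵗ clean g) (forward g ^^ m ++ forward g ^^ buffer ++ tailᶠ) (clean g)
    rooted = clean-rooted g oᶜ pat
      (subst (Follows _ _ _) (++-assoc (forward g ^^ m) _ _) (follows-++ (clean-∈ g pat′)))
      (ℕ.≤-trans long (ℕ.≤-trans (ℕ.m≤n+m _ _) (ℕ.≤-reflexive (sym (length-++ (forward g ^^ m))))))

  backward-lower : m ℕ.* dirtyCost d ≤ cost GF (reverse queries) (tree T)
  backward-lower = begin
    m ℕ.* dirtyCost d                                           ≡⟨ cong (m ℕ.*_) (total-backward g o) ⟨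
    m ℕ.* total h (backward g)                                  ≡⟨ total-^^ h (backward g) m ⟨
    total h (backward g ^^ m)                                 ≤⟨ ℕ.m≤n+m _ _ ⟩
    total h (backwardStart g) ℕ.+ total h (backward g ^^ m)     ≡⟨ total-++ h (backwardStart g) _ ⟨
    total h (backwardStart g ++ backward g ^^ m)              ≤⟨ cost-lower T y o g⊆path rooted calms ⟩
    cost GF (y ∷ (backwardStart g ++ backward g ^^ m) ++ tailᵇ) (tree T)
                                                              ≡⟨ cong (λ ws → cost GF ws (tree T)) reverse-queries ⟨
    cost GF (reverse queries) (tree T)                        ∎
    where
    open ℕ.≤-Reasoning
    h : Fin n → ℕ
    h = depth (dirty g)
    pat : Pattern DirtyStep (_≡ atOuter) g ((backwardStart g ++ backward g ^^ m) ++ backward g ^^ buffer)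
    pat = subst (Pattern DirtyStep (_≡ atOuter) g) backward-split
      (backwardStart-pattern g (backward-pattern-^^ g (m ℕ.+ buffer)))
    pat′ : DirtyPattern g ((backwardStart g ++ backward g ^^ m) ++ backward g ^^ buffer)
    pat′ = pattern-weaken DirtyStep g pat
    long : 5 ^ d ≤ length (backward g ^^ buffer)
    long = length-^^ (backward g) buffer
      (ℕ.≤-trans (ℕ.m^n>0 3 d) (ℕ.≤-reflexive (sym (length-backward g))))
    calms : Calms (dirty g) (backwardStart g ++ backward g ^^ m) tailᵇ
    calms = dirty-calms {ys = backward g ^^ buffer} g o (backwardStart g ++ backward g ^^ m) pat′ long
    rooted : Rooted (_∈ᵗ dirty g) ((backwardStart g ++ backward g ^^ m) ++ tailᵇ) (dirty g)
    rooted = dirty-rooted g o pat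
      (subst (Follows _ _ _) (++-assoc (backwardStart g ++ backward g ^^ m) _ _) (follows-++ (dirty-∈ g pat′)))
      (ℕ.≤-trans long (ℕ.≤-trans (ℕ.m≤n+m _ _) (ℕ.≤-reflexive (sym (length-++ (backwardStart g ++ backward g ^^ m))))))

-- The inequality says (2 - 1/(k + 1)) cost X ≤ cost (reverse X).
Reversal-gap : ℕ → BST n → Set
Reversal-gap {n} k T = Σ[ X ∈ List (Fin n) ] (X ≢ [] ×
  (2 ℕ.* k ℕ.+ 1) ℕ.* cost GF X (tree T) ≤ suc k ℕ.* cost GF (reverse X) (tree T))

gadget-gap : ∀ k (T : BST n) y (g : Gadget n (2 ℕ.* suc k)) → Ordered (dirty g) →
             (∀ {w} → w ∈ᵗ dirty g → w ∈ path y (tree T)) → Reversal-gap k T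
gadget-gap {n} k T y g o g⊆path = queries , (λ ()) ,
  balance k (dirtyCost+2^d e) (ℕ.≤-trans (ℕ.*-monoˡ-≤ (2 ^ e) (ℕ.n≤1+n e)) (cleanCost-≥ e))
    (ℕ.≤-trans (ℕ.m^n>0 2 e) (ℕ.≤-trans (ℕ.m≤n*m (2 ^ e) (suc e)) (cleanCost-≥ e)))
    refl forward-upper backward-lower
  where
  -- Depth e makes the clean cost at least (e + 1) 2^e, hence at least 2(k + 1) times the defect, as
  -- `balance` demands.
  e : ℕ
  e = 2 ℕ.* suc k
  overhead : ℕ
  overhead = n ℕ.+ length (forward g ^^ 5 ^ e ++ forwardStart g ++ [ y ]) ℕ.* n
  open Construction T y g o g⊆path (2 ℕ.* (2 ℕ.* k ℕ.+ 1) ℕ.* overhead)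

reversal-gap : ∀ k (T : BST n) → 2 ^ gadgetSize (2 ℕ.* suc k) ≤ n → Reversal-gap k T
reversal-gap {n} k T N≤n
  with deep-path (gadgetSize (2 ℕ.* suc k)) (tree T) (bst-ordered T)
         (subst (2 ^ gadgetSize (2 ℕ.* suc k) ≤_)
           (sym (trans (cong length (ordered T)) (length-tabulate id))) N≤n)
... | y , zs , _ , incr , onPath , size≤ with gadget (2 ℕ.* suc k) zs size≤
...   | g , _ , refl = gadget-gap k T y g
  (ordered⁺ (dirty g) (proj₁ (AllPairs-++⁻ (inorder (dirty g)) incr)))
  λ w∈ → All.lookup (All.++⁻ˡ (inorder (dirty g)) onPath) (∈ᵗ⇒∈ w∈)

-- A positive rational with denominator k + 1 is at least 1/(k + 1), so 2 - ε is at most (2k + 1)/(k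
-- + 1).
gap-ℚ : ∀ p k .(c : Coprime (suc p) (suc k)) X R → (2 ℕ.* k ℕ.+ 1) ℕ.* X ℕ.≤ suc k ℕ.* R →
        (+ 2 / 1 - mkℚ (+ suc p) k c) * (+ X / 1) ℚ.≤ + R / 1
gap-ℚ p k c X R gap = ℚ.toℚᵘ-cancel-≤ (begin
  toℚᵘ ((+ 2 / 1 - ε) * (+ X / 1))
    ≃⟨ ℚ.toℚᵘ-homo-* (+ 2 / 1 - ε) (+ X / 1) ⟩
  toℚᵘ (+ 2 / 1 - ε) ℚᵘ.* toℚᵘ (+ X / 1)
    ≃⟨ ℚᵘ.*-cong (ℚ.toℚᵘ-homo-+ (+ 2 / 1) (ℚ.- ε)) (ℚ.toℚᵘ-fromℚᵘ (mkℚᵘ (+ X) 0)) ⟩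
  (mkℚᵘ (+ 2) 0 ℚᵘ.- mkℚᵘ (+ suc p) k) ℚᵘ.* mkℚᵘ (+ X) 0
    ≤⟨ *≤* main ⟩
  mkℚᵘ (+ R) 0
    ≃⟨ ℚ.toℚᵘ-fromℚᵘ (mkℚᵘ (+ R) 0) ⟨
  toℚᵘ (+ R / 1) ∎)
  where
  open ℚᵘ.≤-Reasoning
  ε : ℚ
  ε = mkℚ (+ suc p) k c
  -- The inequality is cross-multiplied, with numerators and denominators in the form to which the
  -- unnormalised operations reduce.
  main : ((+ 2 ℤ.* + suc k ℤ.+ -[1+ p ] ℤ.* + 1) ℤ.* + X) ℤ.* + 1 ℤ.≤
         + R ℤ.* + suc ((k ℕ.+ 0) ℕ.* 1)
  main = ℤR.begin
    ((+ 2 ℤ.* + suc k ℤ.+ -[1+ p ] ℤ.* + 1) ℤ.* + X) ℤ.* + 1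
      ℤR.≡⟨ ℤ.*-identityʳ _ ⟩
    (+ 2 ℤ.* + suc k ℤ.+ -[1+ p ] ℤ.* + 1) ℤ.* + X
      ℤR.≡⟨ cong (λ i → (+ 2 ℤ.* + suc k ℤ.+ i) ℤ.* + X) (ℤ.*-identityʳ -[1+ p ]) ⟩
    (+ 2 ℤ.* + suc k ℤ.+ -[1+ p ]) ℤ.* + X
      ℤR.≤⟨ ℤ.*-monoʳ-≤-nonNeg (+ X) (ℤ.+-monoʳ-≤ (+ 2 ℤ.* + suc k) (ℤ.-≤- {m = p} {n = 0} ℕ.z≤n)) ⟩
    (+ 2 ℤ.* (+ 1 ℤ.+ + k) ℤ.+ ℤ.- (+ 1)) ℤ.* + X
      ℤR.≡⟨ expand (+ k) (+ X) ⟩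
    (+ 2 ℤ.* + k ℤ.+ + 1) ℤ.* + X
      ℤR.≡⟨ cong (λ i → (i ℤ.+ + 1) ℤ.* + X) (ℤ.pos-* 2 k) ⟨
    + (2 ℕ.* k ℕ.+ 1) ℤ.* + X
      ℤR.≡⟨ ℤ.pos-* (2 ℕ.* k ℕ.+ 1) X ⟨
    + ((2 ℕ.* k ℕ.+ 1) ℕ.* X)
      ℤR.≤⟨ ℤ.+≤+ gap ⟩
    + (suc k ℕ.* R)
      ℤR.≡⟨ cong +_ (ℕ.*-comm (suc k) R) ⟩
    + (R ℕ.* suc k)
      ℤR.≡⟨ ℤ.pos-* R (suc k) ⟩
    + R ℤ.* + suc k
      ℤR.≡⟨ cong (λ i → + R ℤ.* + suc i) (trans (ℕ.*-identityʳ (k ℕ.+ 0)) (ℕ.+-identityʳ k)) ⟨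
    + R ℤ.* + suc ((k ℕ.+ 0) ℕ.* 1) ℤR.∎
    where
    module ℤR = ℤ.≤-Reasoning
    expand : ∀ k X → (+ 2 ℤ.* (+ 1 ℤ.+ k) ℤ.+ ℤ.- (+ 1)) ℤ.* X ≡ (+ 2 ℤ.* k ℤ.+ + 1) ℤ.* X
    expand = ℤ.solve-∀

theorem4 : (ε : ℚ) → 0ℚ < ε →
    Σ[ N ∈ ℕ ] ((n : ℕ) → N ℕ.≤ n → (T₀ : BST n) →
    Σ[ X ∈ List (Fin n) ] (X ≢ [] ×
    + cost GF (reverse X) (tree T₀) / 1
    ≥ (+ 2 / 1 - ε) * (+ cost GF X (tree T₀) / 1)))
theorem4 (mkℚ (+ zero)  _ _) (*<* (ℤ.+<+ ()))
theorem4 (mkℚ -[1+ _ ]  _ _) (*<* ())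
theorem4 (mkℚ (+ suc p) k c) _ = 2 ℕ.^ gadgetSize (2 ℕ.* suc k) , λ n N≤n T₀ →
  let X , X≢[] , gap = reversal-gap k T₀ N≤n in
  X , X≢[] , gap-ℚ p k c (cost GF X (tree T₀)) (cost GF (reverse X) (tree T₀)) gap
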